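{- There is a function $f(n)=o(n^2)$ (i.e. $f(n)/n^2\to 0$ as $n\to\infty$) such that every diameter-3-critical graph on $n$ vertices has at most $\frac{n^2}{6}+f(n)$ edges.
   Context: All graphs are finite and simple. $d_G(x,y)$ denotes the length of a shortest $(x,y)$-path ($\infty$ if none exists), and the diameter of $G$ is the maximum of $d_G(x,y)$ over all vertex pairs. A graph $G$ is diameter-3-critical if its diameter is 3 and for every edge $e$ the graph $G-e$ has diameter strictly larger than 3. -}

module Defs where

open import Data.Nat using (ℕ; zero; suc; _<?_)
open import Data.Fin using (Fin; toℕ; _≟_)
open import Data.Bool using (Bool; true; false; _∧_; _∨_; not; if_then_else_)
open import Data.List using (List; map; allFin)
open import Data.Nat.ListAction using (sum)
open import Data.Product using (Σ; ∃; ∃-syntax; _×_)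
open import Relation.Nullary using (¬_)
open import Relation.Nullary.Decidable using (⌊_⌋)
open import Relation.Binary.PropositionalEquality using (_≡_)

record Graph (n : ℕ) : Set where
  field
    adj    : Fin n → Fin n → Bool
    sym    : ∀ x y → adj x y ≡ adj y x
    irrefl : ∀ x → adj x x ≡ false
open Graph public

data Within {n : ℕ} (E : Fin n → Fin n → Bool) : ℕ → Fin n → Fin n → Set where
  here : ∀ {k x} → Within E k x x
  step : ∀ {k x y z} → E x y ≡ true → Within E k y z → Within E (suc k) x z

DiamLe : ∀ {n} → (Fin n → Fin n → Bool) → ℕ → Set
DiamLe {n} E k = ∀ (x y : Fin n) → Within E k x y

Diam3 : ∀ {n} → (Fin n → Fin n → Bool) → Set
Diam3 {n} E = DiamLe E 3 × ∃[ x ] ∃[ y ] ¬ Within E 2 x y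

removeEdge : ∀ {n} → (Fin n → Fin n → Bool) → Fin n → Fin n → Fin n → Fin n → Bool
removeEdge E u v x y =
  E x y ∧ not ((⌊ x ≟ u ⌋ ∧ ⌊ y ≟ v ⌋) ∨ (⌊ x ≟ v ⌋ ∧ ⌊ y ≟ u ⌋))

Diam3Critical : ∀ {n} → Graph n → Set
Diam3Critical {n} G =
  Diam3 (adj G) ×
  (∀ (u v : Fin n) → adj G u v ≡ true →
     ∃[ x ] ∃[ y ] ¬ Within (removeEdge (adj G) u v) 3 x y)

edgeCount : ∀ {n} → Graph n → ℕ
edgeCount {n} G =
  sum (map (λ i → sum (map (λ j →
    if adj G i j ∧ ⌊ toℕ i <? toℕ j ⌋ then 1 else 0) (allFin n))) (allFin n))

-- Every edge of a diameter-3-critical graph is of one of two kinds. Either it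
-- lies in no triangle and extends to a path x w y in which w is the only common
-- neighbour of the nonadjacent x, y; or it lies on a path x a b y with d(x,y) = 3
-- and every walk of length 3 from x to y uses it (as first, middle or last edge).
-- Let there be m edges, β of the first kind and γ = m − β of the second.
-- Four disjoint families of vertex pairs then account for 3m − o(n²) pairs:
--   * the m adjacent pairs;
--   * nonadjacent pairs with one common neighbour: each edge is assigned such a
--     pair, at most two edges share one, and the pairs that are shared form
--     triples to which the Ruzsa–Szemerédi theorem applies, so m − o(n²) pairs;
--   * nonadjacent pairs with at least two common neighbours: a graph with β edges
--     has β − o(n²) pairs with two common neighbours, by a count of 2-walks and
--     d/d′ + d′/d ≥ 2;
--   * pairs at distance 3: γ − o(n²), again by Ruzsa–Szemerédi.
-- Hence 3m ≤ n²/2 + o(n²).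
--
-- Ruzsa–Szemerédi: the pairs (p,r) of a triple, coloured by q, form induced
-- matchings. Colour both sides by finitely many classes. If a matching meets both
-- sides of a cell in a proportion 1/h, then the corresponding subrectangle contains
-- only edges of that matching; deleting these (few) edges and splitting the classes
-- makes it empty for good. The total area of empty cells grows by n²/h³ in every
-- round, so after h³ rounds only O(n²/h) triples can be left.
module Submission where

open import Defs hiding (sym)
open import Data.Nat
open import Data.Nat.Properties
open import Data.Nat.DivMod using (n/1≡n; m*n/n≡m; /-monoˡ-≤; m/n*n≤m)
open import Data.Nat.Divisibility using (_∣_; m≤n⇒m!∣n!; m∣m*n; ∣-trans; quotient)
open import Data.Nat.ListAction using () renaming (sum to sumˡ)
open import Data.Nat.Tactic.RingSolver using (solve-∀)
open import Data.Fin using (Fin; zero; suc; toℕ; combine; funToFin; finToFun)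
open import Data.Fin.Properties using (any?; combine-injective; finToFun-funToFin) renaming (_≟_ to _≟ᶠ_)
open import Data.Bool using (Bool; true; false; _∧_; if_then_else_)
open import Data.Bool.Properties using () renaming (_≟_ to _≟ᵇ_)
open import Data.Empty using (⊥; ⊥-elim)
open import Data.List using (map; allFin; tabulate)
open import Data.List.Properties using (map-tabulate)
open import Data.Maybe using (Maybe; just; nothing)
open import Data.Maybe.Properties using (just-injective) renaming (≡-dec to maybe-≟)
open import Data.Maybe.Relation.Unary.Any using (Any; just) renaming (dec to any-just?)
open import Data.Product using (Σ; ∃; ∃-syntax; _×_; _,_; proj₁; proj₂)
open import Data.Product.Properties using () renaming (≡-dec to ×-≟)
open import Data.Sum as Sum using (_⊎_; inj₁; inj₂; [_,_])
open import Relation.Nullary using (Dec; yes; no; ¬_; does; contradiction)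
open import Relation.Nullary.Decidable using (_×-dec_; _⊎-dec_; ¬?; ⌊_⌋)
open import Relation.Binary.PropositionalEquality using (_≡_; _≢_; refl; sym; trans; cong; cong₂; subst)
open import Algebra.Properties.Semiring.Sum +-*-semiring

-- Indicators and finite sums

private variable
  m n : ℕ
  P Q R : Set

⟦_⟧ : Dec P → ℕ
⟦ d ⟧ = if does d then 1 else 0

⟦⟧≤1 : (p : Dec P) → ⟦ p ⟧ ≤ 1
⟦⟧≤1 (yes _) = ≤-refl
⟦⟧≤1 (no _)  = z≤n

⟦⟧-true : (p : Dec P) → P → ⟦ p ⟧ ≡ 1
⟦⟧-true (yes _) _ = refl
⟦⟧-true (no ¬p) p = contradiction p ¬p

⟦⟧-false : (p : Dec P) → ¬ P → ⟦ p ⟧ ≡ 0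
⟦⟧-false (no _)  _  = refl
⟦⟧-false (yes p) ¬p = contradiction p ¬p

⟦⟧-bound : (p : Dec P) {k : ℕ} → (P → 1 ≤ k) → ⟦ p ⟧ ≤ k
⟦⟧-bound (yes p) f = f p
⟦⟧-bound (no _)  _ = z≤n

⟦⟧-pos : (p : Dec P) → P → 1 ≤ ⟦ p ⟧
⟦⟧-pos p x = ≤-reflexive (sym (⟦⟧-true p x))

⟦⟧-mono : (p : Dec P) (q : Dec Q) → (P → Q) → ⟦ p ⟧ ≤ ⟦ q ⟧
⟦⟧-mono p q f = ⟦⟧-bound p λ x → ⟦⟧-pos q (f x)

∑-mono : {f g : Fin n → ℕ} → (∀ i → f i ≤ g i) → sum f ≤ sum g
∑-mono {zero}  _ = z≤n
∑-mono {suc n} h = +-mono-≤ (h zero) (∑-mono λ i → h (suc i))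

∑-const : ∀ n k → ∑[ i < n ] k ≡ n * k
∑-const zero    k = refl
∑-const (suc n) k = cong (k +_) (∑-const n k)

∑-zero : {f : Fin n → ℕ} → (∀ i → f i ≡ 0) → sum f ≡ 0
∑-zero {n = n} h = trans (sum-cong-≗ h) (trans (∑-const n 0) (*-zeroʳ n))

∑-bound : {f : Fin n → ℕ} {k : ℕ} → (∀ i → f i ≤ k) → sum f ≤ n * k
∑-bound {n = n} {k = k} h = ≤-trans (∑-mono h) (≤-reflexive (∑-const n k))

term≤∑ : (f : Fin n → ℕ) (i : Fin n) → f i ≤ sum f
term≤∑ f zero    = m≤m+n _ _
term≤∑ f (suc i) = ≤-trans (term≤∑ (λ j → f (suc j)) i) (m≤n+m _ _)

∑-single : {f : Fin n → ℕ} (i : Fin n) → (∀ j → ¬ j ≡ i → f j ≡ 0) → sum f ≡ f i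
∑-single {f = f} zero    h = trans (cong (f zero +_) (∑-zero λ j → h (suc j) λ ())) (+-identityʳ _)
∑-single {f = f} (suc i) h =
  cong₂ _+_ (h zero λ ()) (∑-single i λ j j≢i → h (suc j) λ { refl → j≢i refl })

∃≤∑ : {P : Fin n → Set} (P? : ∀ i → Dec (P i)) (q : Dec Q) → (Q → ∃ P) → ⟦ q ⟧ ≤ ∑[ i < n ] ⟦ P? i ⟧
∃≤∑ P? q f = ⟦⟧-bound q λ x → let i , p = f x in
  ≤-trans (⟦⟧-pos (P? i) p) (term≤∑ (λ i → ⟦ P? i ⟧) i)

-- How injectivity enters the counts: a coordinate determined by the others is summed out, leaving
-- the indicator of any `Q` that follows from `P`.
∑-unique : {P : Fin n → Set} (P? : ∀ i → Dec (P i)) → (∀ i j → P i → P j → i ≡ j) →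
           (q : Dec Q) → (∀ i → P i → Q) → ∑[ i < n ] ⟦ P? i ⟧ ≤ ⟦ q ⟧
∑-unique {P = P} P? uniq q f with any? P?
... | no ¬p       = ≤-trans (≤-reflexive (∑-zero λ i → ⟦⟧-false (P? i) λ p → ¬p (i , p))) z≤n
... | yes (i , p) = ≤-trans (≤-reflexive (∑-single i λ j j≢i → ⟦⟧-false (P? j) λ p′ → j≢i (uniq j i p′ p)))
                            (⟦⟧-mono (P? i) q (f i))

∑-swap≤ : (f : Fin m → Fin n → ℕ) {k : ℕ} → ∑[ i < m ] ∑[ j < n ] f i j ≤ k → ∑[ j < n ] ∑[ i < m ] f i j ≤ k
∑-swap≤ f = ≤-trans (≤-reflexive (sym (∑-comm f)))

∑∑-distrib-+ : (f g : Fin m → Fin n → ℕ) →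
  ∑[ i < m ] ∑[ j < n ] (f i j + g i j) ≡ ∑[ i < m ] ∑[ j < n ] f i j + ∑[ i < m ] ∑[ j < n ] g i j
∑∑-distrib-+ {m = m} {n = n} f g =
  trans (sum-cong-≗ λ i → ∑-distrib-+ (f i) (g i)) (∑-distrib-+ (λ i → sum (f i)) (λ i → sum (g i)))

∑∑-mono : {f g : Fin m → Fin n → ℕ} → (∀ i j → f i j ≤ g i j) →
  ∑[ i < m ] ∑[ j < n ] f i j ≤ ∑[ i < m ] ∑[ j < n ] g i j
∑∑-mono h = ∑-mono λ i → ∑-mono (h i)

∑-fibre : (c : Fin m → Fin n) (f : Fin m → ℕ) → ∑[ i < m ] f i ≡ ∑[ k < n ] ∑[ i < m ] (⟦ c i ≟ᶠ k ⟧ * f i)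
∑-fibre {m} {n} c f = trans (sum-cong-≗ one) (∑-comm (λ i k → ⟦ c i ≟ᶠ k ⟧ * f i))
  where
  one : ∀ i → f i ≡ ∑[ k < n ] (⟦ c i ≟ᶠ k ⟧ * f i)
  one i = sym (trans (∑-single (c i) λ j j≢ → cong (_* f i) (⟦⟧-false (c i ≟ᶠ j) λ e → j≢ (sym e)))
                     (trans (cong (_* f i) (⟦⟧-true (c i ≟ᶠ c i) refl)) (*-identityˡ _)))

*-∑∑ : ∀ k (f : Fin m → Fin n → ℕ) → k * ∑[ i < m ] ∑[ j < n ] f i j ≡ ∑[ i < m ] ∑[ j < n ] (k * f i j)
*-∑∑ k f = trans (*-distribˡ-sum k (λ i → sum (f i))) (sum-cong-≗ λ i → *-distribˡ-sum k (f i))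

∑*∑ : (f : Fin m → ℕ) (g : Fin n → ℕ) → sum f * sum g ≡ ∑[ i < m ] ∑[ j < n ] (f i * g j)
∑*∑ f g = trans (*-distribʳ-sum (sum g) f) (sum-cong-≗ λ i → *-distribˡ-sum (f i) g)

⟦⟧-disjoint : (p : Dec P) (q : Dec Q) (r : Dec R) → (P → R) → (Q → R) → (P → ¬ Q) → ⟦ p ⟧ + ⟦ q ⟧ ≤ ⟦ r ⟧
⟦⟧-disjoint (yes x) (yes y) r f g h = contradiction y (h x)
⟦⟧-disjoint (yes x) (no _)  r f g h = ⟦⟧-pos r (f x)
⟦⟧-disjoint (no _)  q       r f g h = ⟦⟧-mono q r g

⟦⟧-cut : (p : Dec P) (q : Dec Q) → ⟦ p ⟧ ≤ ⟦ p ×-dec ¬? q ⟧ + ⟦ p ×-dec q ⟧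
⟦⟧-cut (no _)  _       = z≤n
⟦⟧-cut (yes _) (yes _) = ≤-refl
⟦⟧-cut (yes _) (no _)  = ≤-refl

⟦⟧-× : (p : Dec P) (q : Dec Q) → ⟦ p ⟧ * ⟦ q ⟧ ≤ ⟦ p ×-dec q ⟧
⟦⟧-× (yes x) q = ≤-trans (≤-reflexive (*-identityˡ _)) (⟦⟧-mono q (yes x ×-dec q) λ y → x , y)
⟦⟧-× (no _)  q = z≤n

-- The Ruzsa–Szemerédi theorem

module Light {n κ : ℕ} (h : ℕ) (c : Fin n → Fin κ) {A : Fin n → Set} (A? : ∀ p → Dec (A p)) where

  -- The factor 1 gives class sizes the shape that `∑-fibre` produces, so that sizes and masses are
  -- fibre sums of two weights.
  class mass : Fin κ → ℕ
  class i = ∑[ p < n ] (⟦ c p ≟ᶠ i ⟧ * 1)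
  mass  i = ∑[ p < n ] (⟦ c p ≟ᶠ i ⟧ * ⟦ A? p ⟧)

  Heavy : Fin κ → Set
  Heavy i = class i ≤ h * mass i

  heavy? : ∀ i → Dec (Heavy i)
  heavy? i = class i ≤? h * mass i

  -- In a light class the elements of `A` make up less than 1/h of the class, and the classes add up
  -- to n. Heavy classes contribute nothing.
  light-≤ : h * ∑[ p < n ] ⟦ A? p ×-dec ¬? (heavy? (c p)) ⟧ ≤ n
  light-≤ = begin
    h * ∑[ p < n ] ⟦ A? p ×-dec ¬? (heavy? (c p)) ⟧
      ≡⟨ cong (h *_) (∑-fibre c _) ⟩
    h * ∑[ i < κ ] ∑[ p < n ] (⟦ c p ≟ᶠ i ⟧ * ⟦ A? p ×-dec ¬? (heavy? (c p)) ⟧)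
      ≡⟨ *-distribˡ-sum {κ} h _ ⟩
    ∑[ i < κ ] (h * ∑[ p < n ] (⟦ c p ≟ᶠ i ⟧ * ⟦ A? p ×-dec ¬? (heavy? (c p)) ⟧))
      ≤⟨ ∑-mono per-class ⟩
    ∑[ i < κ ] class i
      ≡⟨ ∑-fibre c (λ _ → 1) ⟨
    ∑[ p < n ] 1
      ≡⟨ trans (∑-const n 1) (*-identityʳ n) ⟩
    n ∎
    where
    open ≤-Reasoning
    per-class : ∀ i → h * ∑[ p < n ] (⟦ c p ≟ᶠ i ⟧ * ⟦ A? p ×-dec ¬? (heavy? (c p)) ⟧) ≤ class i
    per-class i with heavy? i
    ... | yes H = ≤-trans (≤-reflexive (trans (cong (h *_) (∑-zero none)) (*-zeroʳ h))) z≤n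
      where
      none : ∀ p → ⟦ c p ≟ᶠ i ⟧ * ⟦ A? p ×-dec ¬? (heavy? (c p)) ⟧ ≡ 0
      none p with c p ≟ᶠ i
      ... | no _     = refl
      ... | yes refl = trans (*-identityˡ _) (⟦⟧-false (A? p ×-dec ¬? (heavy? (c p))) λ (_ , ¬H) → ¬H H)
    ... | no ¬H = ≤-trans (*-monoʳ-≤ h (∑-mono λ p → *-monoʳ-≤ ⟦ c p ≟ᶠ i ⟧
                     (⟦⟧-mono (A? p ×-dec ¬? (heavy? (c p))) (A? p) proj₁)))
                     (<⇒≤ (≰⇒> ¬H))

-- The field closed is the Ruzsa–Szemerédi hypothesis: whenever three triples
-- pairwise supply the pairs pq, qr and pr, they are the same triple.
record System (n : ℕ) : Set₁ where
  field
    K      : Fin n → Fin n → Fin n → Set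
    K?     : ∀ p q r → Dec (K p q r)
    closed : ∀ {p p′ q q′ r r′} → K p q r′ → K p′ q r → K p q′ r → p ≡ p′ × q ≡ q′ × r ≡ r′

  size : ℕ
  size = ∑[ p < n ] ∑[ q < n ] ∑[ r < n ] ⟦ K? p q r ⟧

  -- Any two coordinates of a triple determine the third: with one triple repeated, two triples form
  -- an instance of `closed`.
  r-unique : ∀ {p q r r′} → K p q r → K p q r′ → r ≡ r′
  r-unique k k′ = sym (proj₂ (proj₂ (closed k k′ k′)))

  p-unique : ∀ {p p′ q r} → K p q r → K p′ q r → p ≡ p′
  p-unique k k′ = proj₁ (closed k k′ k)

  q-unique : ∀ {p q q′ r} → K p q r → K p q′ r → q ≡ q′
  q-unique k k′ = proj₁ (proj₂ (closed k k k′))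

  ∃q? : ∀ p r → Dec (∃ λ q → K p q r)
  ∃q? p r = any? λ q → K? p q r

  ∃r? : ∀ q p → Dec (∃ λ r → K p q r)
  ∃r? q p = any? λ r → K? p q r

  ∃p? : ∀ q r → Dec (∃ λ p → K p q r)
  ∃p? q r = any? λ p → K? p q r

open System

∑q≤ : ∀ {n} (S : System n) {P : Fin n → Fin n → Fin n → Set} (P? : ∀ p q r → Dec (P p q r)) →
      (∀ {p q r} → P p q r → K S p q r) →
      {Q : Fin n → Fin n → Set} (Q? : ∀ p r → Dec (Q p r)) → (∀ {p q r} → P p q r → Q p r) →
      ∑[ p < n ] ∑[ q < n ] ∑[ r < n ] ⟦ P? p q r ⟧ ≤ ∑[ p < n ] ∑[ r < n ] ⟦ Q? p r ⟧
∑q≤ S P? P⊆K Q? P⊆Q = ∑-mono λ p → ∑-swap≤ (λ r q → ⟦ P? p q r ⟧)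
  (∑-mono λ r → ∑-unique (λ q → P? p q r) (λ q q′ x y → q-unique S (P⊆K x) (P⊆K y)) (Q? p r) λ q → P⊆Q)

module Cells {n κ : ℕ} (S : System n) (c d : Fin n → Fin κ) where

  -- Here p and r enter only through their classes, so `area` is the total size of the cells that
  -- still meet a triple.
  Occupied : Fin n → Fin n → Set
  Occupied p r = ∃ λ p₁ → ∃ λ r₁ → (∃ λ q → K S p₁ q r₁) × c p₁ ≡ c p × d r₁ ≡ d r

  occupied? : ∀ p r → Dec (Occupied p r)
  occupied? p r = any? λ p₁ → any? λ r₁ → ∃q? S p₁ r₁ ×-dec c p₁ ≟ᶠ c p ×-dec d r₁ ≟ᶠ d r

  area : ℕ
  area = ∑[ p < n ] ∑[ r < n ] ⟦ occupied? p r ⟧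

  size≤area : size S ≤ area
  size≤area = ∑q≤ S (K? S) (λ k → k) occupied? λ k → _ , _ , (_ , k) , refl , refl

module Refine {n κ : ℕ} (S : System n) (h : ℕ) (c d : Fin n → Fin κ) where
  open Cells S c d
  module LP (q : Fin n) = Light h c (∃r? S q)
  module LR (q : Fin n) = Light h d (∃p? S q)

  -- For fixed q the pairs (p,r) form a matching, and `LP q`, `LR q` measure its left and right
  -- endpoints. A triple is good if its matching fills at least 1/h of both sides of its cell.
  Good : Fin n → Fin n → Fin n → Set
  Good p q r = K S p q r × LP.Heavy q (c p) × LR.Heavy q (d r)

  good? : ∀ p q r → Dec (Good p q r)
  good? p q r = K? S p q r ×-dec LP.heavy? q (c p) ×-dec LR.heavy? q (d r)

  good : ℕ
  good = ∑[ p < n ] ∑[ q < n ] ∑[ r < n ] ⟦ good? p q r ⟧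

  badP? : ∀ p q r → Dec (K S p q r × ¬ LP.Heavy q (c p))
  badP? p q r = K? S p q r ×-dec ¬? (LP.heavy? q (c p))

  badR? : ∀ p q r → Dec (K S p q r × ¬ LR.Heavy q (d r))
  badR? p q r = K? S p q r ×-dec ¬? (LR.heavy? q (d r))

  badP badR : ℕ
  badP = ∑[ p < n ] ∑[ q < n ] ∑[ r < n ] ⟦ badP? p q r ⟧
  badR = ∑[ p < n ] ∑[ q < n ] ∑[ r < n ] ⟦ badR? p q r ⟧

  size≤ : size S ≤ good + (badP + badR)
  size≤ = begin
    size S
      ≤⟨ ∑-mono (λ p → ∑∑-mono λ q r → split p q r) ⟩
    ∑[ p < n ] ∑[ q < n ] ∑[ r < n ] (⟦ good? p q r ⟧ + (⟦ badP? p q r ⟧ + ⟦ badR? p q r ⟧))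
      ≡⟨ sum-cong-≗ (λ p → ∑∑-distrib-+ (λ q r → ⟦ good? p q r ⟧) _) ⟩
    ∑[ p < n ] (∑[ q < n ] ∑[ r < n ] ⟦ good? p q r ⟧ + ∑[ q < n ] ∑[ r < n ] (⟦ badP? p q r ⟧ + ⟦ badR? p q r ⟧))
      ≡⟨ ∑-distrib-+ {n} _ _ ⟩
    good + ∑[ p < n ] ∑[ q < n ] ∑[ r < n ] (⟦ badP? p q r ⟧ + ⟦ badR? p q r ⟧)
      ≡⟨ cong (good +_) (trans (sum-cong-≗ (λ p → ∑∑-distrib-+ (λ q r → ⟦ badP? p q r ⟧) _)) (∑-distrib-+ {n} _ _)) ⟩
    good + (badP + badR) ∎
    where
    open ≤-Reasoning
    split : ∀ p q r → ⟦ K? S p q r ⟧ ≤ ⟦ good? p q r ⟧ + (⟦ badP? p q r ⟧ + ⟦ badR? p q r ⟧)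
    split p q r = ⟦⟧-bound (K? S p q r) λ k → cases k (LP.heavy? q (c p)) (LR.heavy? q (d r))
      where
      cases : K S p q r → Dec (LP.Heavy q (c p)) → Dec (LR.Heavy q (d r)) →
              1 ≤ ⟦ good? p q r ⟧ + (⟦ badP? p q r ⟧ + ⟦ badR? p q r ⟧)
      cases k (yes H) (yes H′) = ≤-trans (⟦⟧-pos (good? p q r) (k , H , H′)) (m≤m+n _ _)
      cases k (no ¬H) _        = ≤-trans (≤-trans (⟦⟧-pos (badP? p q r) (k , ¬H)) (m≤m+n _ _)) (m≤n+m _ ⟦ good? p q r ⟧)
      cases k (yes _) (no ¬H)  = ≤-trans (≤-trans (⟦⟧-pos (badR? p q r) (k , ¬H)) (m≤n+m _ ⟦ badP? p q r ⟧)) (m≤n+m _ ⟦ good? p q r ⟧)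

  -- Since r is unique, a bad triple is counted by (p,q), and `light-≤` leaves at most n/h points p
  -- for each q.
  badP≤ : h * badP ≤ n * n
  badP≤ = begin
    h * badP
      ≤⟨ *-monoʳ-≤ h (∑-mono λ p → ∑-mono λ q →
           ∑-unique (badP? p q) (λ r r′ (k , _) (k′ , _) → r-unique S k k′)
                    (∃r? S q p ×-dec ¬? (LP.heavy? q (c p))) λ r (k , l) → (r , k) , l) ⟩
    h * ∑[ p < n ] ∑[ q < n ] ⟦ ∃r? S q p ×-dec ¬? (LP.heavy? q (c p)) ⟧
      ≡⟨ cong (h *_) (∑-comm λ p q → ⟦ ∃r? S q p ×-dec ¬? (LP.heavy? q (c p)) ⟧) ⟩
    h * ∑[ q < n ] ∑[ p < n ] ⟦ ∃r? S q p ×-dec ¬? (LP.heavy? q (c p)) ⟧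
      ≡⟨ *-distribˡ-sum {n} h _ ⟩
    ∑[ q < n ] (h * ∑[ p < n ] ⟦ ∃r? S q p ×-dec ¬? (LP.heavy? q (c p)) ⟧)
      ≤⟨ ∑-bound (λ q → LP.light-≤ q) ⟩
    n * n ∎
    where open ≤-Reasoning

  badR≤ : h * badR ≤ n * n
  badR≤ = begin
    h * badR
      ≡⟨ cong (h *_) (trans (sum-cong-≗ λ p → ∑-comm λ q r → ⟦ badR? p q r ⟧)
                     (trans (∑-comm λ p r → ∑[ q < n ] ⟦ badR? p q r ⟧)
                            (sum-cong-≗ λ r → ∑-comm λ p q → ⟦ badR? p q r ⟧))) ⟩
    h * ∑[ r < n ] ∑[ q < n ] ∑[ p < n ] ⟦ badR? p q r ⟧
      ≤⟨ *-monoʳ-≤ h (∑-mono λ r → ∑-mono λ q →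
           ∑-unique (λ p → badR? p q r) (λ p p′ (k , _) (k′ , _) → p-unique S k k′)
                    (∃p? S q r ×-dec ¬? (LR.heavy? q (d r))) λ p (k , l) → (p , k) , l) ⟩
    h * ∑[ r < n ] ∑[ q < n ] ⟦ ∃p? S q r ×-dec ¬? (LR.heavy? q (d r)) ⟧
      ≡⟨ cong (h *_) (∑-comm λ r q → ⟦ ∃p? S q r ×-dec ¬? (LR.heavy? q (d r)) ⟧) ⟩
    h * ∑[ q < n ] ∑[ r < n ] ⟦ ∃p? S q r ×-dec ¬? (LR.heavy? q (d r)) ⟧
      ≡⟨ *-distribˡ-sum {n} h _ ⟩
    ∑[ q < n ] (h * ∑[ r < n ] ⟦ ∃p? S q r ×-dec ¬? (LR.heavy? q (d r)) ⟧)
      ≤⟨ ∑-bound (λ q → LR.light-≤ q) ⟩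
    n * n ∎
    where open ≤-Reasoning

  mostly-good : h * size S ≤ h * good + 2 * (n * n)
  mostly-good = begin
    h * size S                     ≤⟨ *-monoʳ-≤ h size≤ ⟩
    h * (good + (badP + badR))     ≡⟨ expand h good badP badR ⟩
    h * good + (h * badP + h * badR) ≤⟨ +-monoʳ-≤ (h * good) (+-mono-≤ badP≤ badR≤) ⟩
    h * good + (n * n + n * n)     ≡⟨ cong (λ z → h * good + (n * n + z)) (+-identityʳ (n * n)) ⟨
    h * good + 2 * (n * n)         ∎
    where
    open ≤-Reasoning
    expand : ∀ h g a b → h * (g + (a + b)) ≡ h * g + (h * a + h * b)
    expand = solve-∀

  GoodCell : Fin κ → Fin κ → Set
  GoodCell i j = ∃ λ q → ∃ λ p → ∃ λ r → Good p q r × c p ≡ i × d r ≡ j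

  goodCell? : ∀ i j → Dec (GoodCell i j)
  goodCell? i j = any? λ q → any? λ p → any? λ r → good? p q r ×-dec c p ≟ᶠ i ×-dec d r ≟ᶠ j

  -- A good cell may have several heavy matchings, of which one is fixed here. In all other cells
  -- `nothing` makes both sides of the box empty.
  colour : Fin κ → Fin κ → Maybe (Fin n)
  colour i j with goodCell? i j
  ... | yes (q , _) = just q
  ... | no _        = nothing

  colour-good : ∀ i j → GoodCell i j → ∃ λ q → colour i j ≡ just q × LP.Heavy q i × LR.Heavy q j
  colour-good i j g with goodCell? i j
  ... | yes (q , p , r , (_ , H , H′) , refl , refl) = q , refl , H , H′
  ... | no ¬g = contradiction g ¬g

  colour-cell : ∀ i j {q} → colour i j ≡ just q → GoodCell i j
  colour-cell i j e with goodCell? i j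
  ... | yes g = g

  X Y : Fin κ → Fin κ → Fin n → Set
  X i j p = Any (λ q → ∃ λ r → K S p q r) (colour i j)
  Y i j r = Any (λ q → ∃ λ p → K S p q r) (colour i j)

  X? : ∀ i j p → Dec (X i j p)
  X? i j p = any-just? (λ q → ∃r? S q p) (colour i j)

  Y? : ∀ i j r → Dec (Y i j r)
  Y? i j r = any-just? (λ q → ∃p? S q r) (colour i j)

  -- In each good cell, the left endpoints times the right endpoints of the chosen matching. As
  -- matchings are induced, every triple over this rectangle belongs to that matching.
  Box : Fin n → Fin n → Set
  Box p r = X (c p) (d r) p × Y (c p) (d r) r

  box? : ∀ p r → Dec (Box p r)
  box? p r = X? (c p) (d r) p ×-dec Y? (c p) (d r) r

  box : ℕ
  box = ∑[ p < n ] ∑[ r < n ] ⟦ box? p r ⟧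

  box-colour : ∀ {i j p r} → X i j p → Y i j r →
    ∃ λ q → colour i j ≡ just q × (∃ λ r₁ → K S p q r₁) × (∃ λ p₁ → K S p₁ q r)
  box-colour {i} {j} x y with colour i j
  box-colour (just x) (just y) | just q = q , refl , x , y

  S′ : System n
  S′ .K p q r      = K S p q r × ¬ Box p r
  S′ .K? p q r     = K? S p q r ×-dec ¬? (box? p r)
  S′ .closed (k , _) (k′ , _) (k″ , _) = closed S k k′ k″

  -- A new class records the old class and, for each of the κ classes of the opposite side, one bit
  -- for membership in the side of the box.
  κ′ : ℕ
  κ′ = κ * 2 ^ κ

  bit : {P : Set} → Dec P → Fin 2
  bit (yes _) = suc zero
  bit (no _)  = zero

  bit-inj : {P Q : Set} (p : Dec P) (q : Dec Q) → bit p ≡ bit q → P → Q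
  bit-inj (yes _) (yes q) _ _ = q
  bit-inj (no ¬p) _       _ p = contradiction p ¬p

  c′ d′ : Fin n → Fin κ′
  c′ p = combine (c p) (funToFin λ j → bit (X? (c p) j p))
  d′ r = combine (d r) (funToFin λ i → bit (Y? i (d r) r))

  funToFin-inj : {f g : Fin κ → Fin 2} → funToFin f ≡ funToFin g → ∀ i → f i ≡ g i
  funToFin-inj {f} {g} e i = trans (sym (finToFun-funToFin f i)) (trans (cong (λ z → finToFun z i) e) (finToFun-funToFin g i))

  c′-refines : ∀ {p p₁} → c′ p ≡ c′ p₁ → c p ≡ c p₁ × (∀ j → X (c p) j p → X (c p₁) j p₁)
  c′-refines {p} {p₁} e = let e₁ , e₂ = combine-injective (c p) _ (c p₁) _ e in
    e₁ , λ j → bit-inj (X? (c p) j p) (X? (c p₁) j p₁) (funToFin-inj e₂ j)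

  d′-refines : ∀ {r r₁} → d′ r ≡ d′ r₁ → d r ≡ d r₁ × (∀ i → Y i (d r) r → Y i (d r₁) r₁)
  d′-refines {r} {r₁} e = let e₁ , e₂ = combine-injective (d r) _ (d r₁) _ e in
    e₁ , λ i → bit-inj (Y? i (d r) r) (Y? i (d r₁) r₁) (funToFin-inj e₂ i)

  module C′ = Cells S′ c′ d′

  -- A box is a union of refined cells. It lies in an occupied cell of the old colouring, but its
  -- triples are gone from `S′`, so its refined cells are empty.
  area-drop : C′.area + box ≤ area
  area-drop = ≤-trans (≤-reflexive (sym (∑∑-distrib-+ (λ p r → ⟦ C′.occupied? p r ⟧) (λ p r → ⟦ box? p r ⟧))))
                      (∑∑-mono pointwise)
    where
    box⇒occupied : ∀ p r → Box p r → Occupied p r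
    box⇒occupied p r (x , y) =
      let _ , e , _ = box-colour x y
          q , p₁ , r₁ , (k , _) , cp , dr = colour-cell (c p) (d r) e
      in p₁ , r₁ , (q , k) , cp , dr
    occupied′⇒occupied : ∀ p r → C′.Occupied p r → Occupied p r
    occupied′⇒occupied p r (p₁ , r₁ , (q , k , _) , cp , dr) =
      p₁ , r₁ , (q , k) , proj₁ (c′-refines cp) , proj₁ (d′-refines dr)
    disjoint : ∀ p r → Box p r → ¬ C′.Occupied p r
    disjoint p r (x , y) (p₁ , r₁ , (q , k , ¬box) , cp , dr) =
      let e₁ , f = c′-refines (sym cp)
          e₂ , g = d′-refines (sym dr)
      in ¬box (subst (λ j → X (c p₁) j p₁) e₂ (f (d r) x) , subst (λ i → Y i (d r₁) r₁) e₁ (g (c p) y))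
    pointwise : ∀ p r → ⟦ C′.occupied? p r ⟧ + ⟦ box? p r ⟧ ≤ ⟦ occupied? p r ⟧
    pointwise p r = ⟦⟧-disjoint (C′.occupied? p r) (box? p r) (occupied? p r)
      (occupied′⇒occupied p r) (box⇒occupied p r) (λ o b → disjoint p r b o)

  -- For each p, every class of r loses at most one triple, so the loss is linear in n for fixed κ.
  removed≤ : size S ≤ size S′ + κ * n
  removed≤ = begin
    size S
      ≤⟨ ∑-mono (λ p → ∑∑-mono λ q r → ⟦⟧-cut (K? S p q r) (box? p r)) ⟩
    ∑[ p < n ] ∑[ q < n ] ∑[ r < n ] (⟦ K? S′ p q r ⟧ + ⟦ gone? p q r ⟧)
      ≡⟨ sum-cong-≗ (λ p → ∑∑-distrib-+ (λ q r → ⟦ K? S′ p q r ⟧) _) ⟩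
    ∑[ p < n ] (∑[ q < n ] ∑[ r < n ] ⟦ K? S′ p q r ⟧ + ∑[ q < n ] ∑[ r < n ] ⟦ gone? p q r ⟧)
      ≡⟨ ∑-distrib-+ {n} _ _ ⟩
    size S′ + ∑[ p < n ] ∑[ q < n ] ∑[ r < n ] ⟦ gone? p q r ⟧
      ≤⟨ +-monoʳ-≤ (size S′) (≤-trans (∑-bound few-gone) (≤-reflexive (*-comm n κ))) ⟩
    size S′ + κ * n ∎
    where
    open ≤-Reasoning
    gone? : ∀ p q r → Dec (K S p q r × Box p r)
    gone? p q r = K? S p q r ×-dec box? p r
    -- Inside a box every triple has the colour of the cell, so p and the class of r determine it.
    pinned : ∀ {p q r} → K S p q r → Box p r → colour (c p) (d r) ≡ just q
    pinned k (x , y) = let q₀ , e , (_ , k₁) , (_ , k₂) = box-colour x y in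
      trans e (cong just (proj₁ (proj₂ (closed S k₁ k₂ k))))
    few-gone : ∀ p → ∑[ q < n ] ∑[ r < n ] ⟦ gone? p q r ⟧ ≤ κ
    few-gone p = begin
      ∑[ q < n ] ∑[ r < n ] ⟦ gone? p q r ⟧
        ≡⟨ ∑-comm (λ q r → ⟦ gone? p q r ⟧) ⟩
      ∑[ r < n ] ∑[ q < n ] ⟦ gone? p q r ⟧
        ≤⟨ ∑-mono (λ r → ∑-unique (λ q → gone? p q r) (λ q q′ (k , _) (k′ , _) → q-unique S k k′)
              (∃q? S p r ×-dec box? p r) λ q (k , b) → (q , k) , b) ⟩
      ∑[ r < n ] ⟦ ∃q? S p r ×-dec box? p r ⟧
        ≡⟨ ∑-fibre d _ ⟩
      ∑[ j < κ ] ∑[ r < n ] (⟦ d r ≟ᶠ j ⟧ * ⟦ ∃q? S p r ×-dec box? p r ⟧)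
        ≤⟨ ∑-bound (λ j → ≤-trans (∑-mono λ r → ⟦⟧-× (d r ≟ᶠ j) (∃q? S p r ×-dec box? p r))
             (∑-unique (λ r → (d r ≟ᶠ j) ×-dec (∃q? S p r ×-dec box? p r)) (same j) (yes refl) λ _ _ → refl {x = n})) ⟩
      κ * 1 ≡⟨ *-identityʳ κ ⟩
      κ ∎
      where
      same : ∀ j r r′ → d r ≡ j × (∃ λ q → K S p q r) × Box p r → d r′ ≡ j × (∃ λ q → K S p q r′) × Box p r′ → r ≡ r′
      same j r r′ (refl , (q , k) , b) (e , (q′ , k′) , b′) =
        r-unique S k (subst (λ q → K S p q r′) (just-injective (trans (sym (pinned k′ b′)) (trans (cong (colour (c p)) e) (pinned k b)))) k′)

  -- In a good cell the chosen matching reaches at least 1/h of either side, so the box fills at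
  -- least 1/h² of the cell. The good triples inject into the pairs of good cells.
  box-large : good ≤ h * h * box
  box-large = begin
    good
      ≤⟨ ∑q≤ S good? proj₁ (λ p r → goodCell? (c p) (d r)) (λ {p} {q} {r} g → q , p , r , g , refl , refl) ⟩
    ∑[ p < n ] ∑[ r < n ] ⟦ goodCell? (c p) (d r) ⟧
      ≡⟨ fibre² (λ p r → ⟦ goodCell? (c p) (d r) ⟧) ⟩
    ∑[ i < κ ] ∑[ j < κ ] ∑[ p < n ] ∑[ r < n ] (⟦ c p ≟ᶠ i ⟧ * (⟦ d r ≟ᶠ j ⟧ * ⟦ goodCell? (c p) (d r) ⟧))
      ≤⟨ ∑∑-mono cell ⟩
    ∑[ i < κ ] ∑[ j < κ ] (h * h * ∑[ p < n ] ∑[ r < n ] (⟦ c p ≟ᶠ i ⟧ * (⟦ d r ≟ᶠ j ⟧ * ⟦ box? p r ⟧)))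
      ≡⟨ *-∑∑ {κ} {κ} (h * h) _ ⟨
    h * h * ∑[ i < κ ] ∑[ j < κ ] ∑[ p < n ] ∑[ r < n ] (⟦ c p ≟ᶠ i ⟧ * (⟦ d r ≟ᶠ j ⟧ * ⟦ box? p r ⟧))
      ≡⟨ cong (h * h *_) (fibre² (λ p r → ⟦ box? p r ⟧)) ⟨
    h * h * box ∎
    where
    open ≤-Reasoning
    fibre² : (f : Fin n → Fin n → ℕ) → ∑[ p < n ] ∑[ r < n ] f p r ≡
             ∑[ i < κ ] ∑[ j < κ ] ∑[ p < n ] ∑[ r < n ] (⟦ c p ≟ᶠ i ⟧ * (⟦ d r ≟ᶠ j ⟧ * f p r))
    fibre² f = begin-equality
      ∑[ p < n ] ∑[ r < n ] f p r
        ≡⟨ ∑-fibre c _ ⟩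
      ∑[ i < κ ] ∑[ p < n ] (⟦ c p ≟ᶠ i ⟧ * ∑[ r < n ] f p r)
        ≡⟨ sum-cong-≗ (λ i → sum-cong-≗ λ p → trans (cong (⟦ c p ≟ᶠ i ⟧ *_) (∑-fibre d (f p))) (*-distribˡ-sum {κ} ⟦ c p ≟ᶠ i ⟧ (λ j → ∑[ r < n ] (⟦ d r ≟ᶠ j ⟧ * f p r)))) ⟩
      ∑[ i < κ ] ∑[ p < n ] ∑[ j < κ ] (⟦ c p ≟ᶠ i ⟧ * ∑[ r < n ] (⟦ d r ≟ᶠ j ⟧ * f p r))
        ≡⟨ sum-cong-≗ {κ} (λ i → ∑-comm {n} {κ} λ p j → ⟦ c p ≟ᶠ i ⟧ * ∑[ r < n ] (⟦ d r ≟ᶠ j ⟧ * f p r)) ⟩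
      ∑[ i < κ ] ∑[ j < κ ] ∑[ p < n ] (⟦ c p ≟ᶠ i ⟧ * ∑[ r < n ] (⟦ d r ≟ᶠ j ⟧ * f p r))
        ≡⟨ sum-cong-≗ {κ} (λ i → sum-cong-≗ {κ} λ j → sum-cong-≗ {n} λ p → *-distribˡ-sum {n} ⟦ c p ≟ᶠ i ⟧ (λ r → ⟦ d r ≟ᶠ j ⟧ * f p r)) ⟩
      ∑[ i < κ ] ∑[ j < κ ] ∑[ p < n ] ∑[ r < n ] (⟦ c p ≟ᶠ i ⟧ * (⟦ d r ≟ᶠ j ⟧ * f p r)) ∎
    interchange : ∀ h a b → h * a * (h * b) ≡ h * h * (a * b)
    interchange = solve-∀
    product : ∀ a x b y → a * x * (b * y) ≡ a * (b * (x * y))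
    product = solve-∀
    cell : ∀ i j → ∑[ p < n ] ∑[ r < n ] (⟦ c p ≟ᶠ i ⟧ * (⟦ d r ≟ᶠ j ⟧ * ⟦ goodCell? (c p) (d r) ⟧)) ≤
           h * h * ∑[ p < n ] ∑[ r < n ] (⟦ c p ≟ᶠ i ⟧ * (⟦ d r ≟ᶠ j ⟧ * ⟦ box? p r ⟧))
    cell i j = case (goodCell? i j)
      where
      case : Dec (GoodCell i j) → _
      case (no ¬g) = ≤-trans (≤-reflexive (∑-zero λ p → ∑-zero λ r → none p r)) z≤n
        where
        none : ∀ p r → ⟦ c p ≟ᶠ i ⟧ * (⟦ d r ≟ᶠ j ⟧ * ⟦ goodCell? (c p) (d r) ⟧) ≡ 0
        none p r with c p ≟ᶠ i | d r ≟ᶠ j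
        ... | no _     | _        = refl
        ... | yes _    | no _     = refl
        ... | yes refl | yes refl = trans (trans (*-identityˡ _) (*-identityˡ _)) (⟦⟧-false (goodCell? (c p) (d r)) ¬g)
      case (yes g) with colour-good i j g
      ... | q , e , H , H′ = begin
        ∑[ p < n ] ∑[ r < n ] (⟦ c p ≟ᶠ i ⟧ * (⟦ d r ≟ᶠ j ⟧ * ⟦ goodCell? (c p) (d r) ⟧))
          ≤⟨ ∑∑-mono (λ p r → *-monoʳ-≤ ⟦ c p ≟ᶠ i ⟧ (*-monoʳ-≤ ⟦ d r ≟ᶠ j ⟧ (⟦⟧≤1 (goodCell? (c p) (d r))))) ⟩
        ∑[ p < n ] ∑[ r < n ] (⟦ c p ≟ᶠ i ⟧ * (⟦ d r ≟ᶠ j ⟧ * 1))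
          ≡⟨ sum-cong-≗ (λ p → sum-cong-≗ λ r → cong (_* (⟦ d r ≟ᶠ j ⟧ * 1)) (*-identityʳ ⟦ c p ≟ᶠ i ⟧)) ⟨
        ∑[ p < n ] ∑[ r < n ] (⟦ c p ≟ᶠ i ⟧ * 1 * (⟦ d r ≟ᶠ j ⟧ * 1))
          ≡⟨ ∑*∑ {n} {n} _ _ ⟨
        LP.class q i * LR.class q j
          ≤⟨ *-mono-≤ H H′ ⟩
        h * LP.mass q i * (h * LR.mass q j)
          ≡⟨ interchange h (LP.mass q i) (LR.mass q j) ⟩
        h * h * (LP.mass q i * LR.mass q j)
          ≡⟨ cong (h * h *_) (∑*∑ {n} {n} _ _) ⟩
        h * h * ∑[ p < n ] ∑[ r < n ] (⟦ c p ≟ᶠ i ⟧ * ⟦ ∃r? S q p ⟧ * (⟦ d r ≟ᶠ j ⟧ * ⟦ ∃p? S q r ⟧))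
          ≤⟨ *-monoʳ-≤ (h * h) (∑∑-mono in-box) ⟩
        h * h * ∑[ p < n ] ∑[ r < n ] (⟦ c p ≟ᶠ i ⟧ * (⟦ d r ≟ᶠ j ⟧ * ⟦ box? p r ⟧)) ∎
        where
        in-box : ∀ p r → ⟦ c p ≟ᶠ i ⟧ * ⟦ ∃r? S q p ⟧ * (⟦ d r ≟ᶠ j ⟧ * ⟦ ∃p? S q r ⟧) ≤ ⟦ c p ≟ᶠ i ⟧ * (⟦ d r ≟ᶠ j ⟧ * ⟦ box? p r ⟧)
        in-box p r = ≤-trans (≤-reflexive (product ⟦ c p ≟ᶠ i ⟧ ⟦ ∃r? S q p ⟧ ⟦ d r ≟ᶠ j ⟧ ⟦ ∃p? S q r ⟧)) (main p r)
          where
          member : {P : Fin n → Set} → P q → Any P (colour i j)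
          member {P} y = subst (Any P) (sym e) (just y)
          main : ∀ p r → ⟦ c p ≟ᶠ i ⟧ * (⟦ d r ≟ᶠ j ⟧ * (⟦ ∃r? S q p ⟧ * ⟦ ∃p? S q r ⟧)) ≤ ⟦ c p ≟ᶠ i ⟧ * (⟦ d r ≟ᶠ j ⟧ * ⟦ box? p r ⟧)
          main p r with c p ≟ᶠ i | d r ≟ᶠ j
          ... | no _     | _        = z≤n
          ... | yes _    | no _     = z≤n
          ... | yes refl | yes refl = *-monoʳ-≤ 1 (*-monoʳ-≤ 1 (≤-trans (⟦⟧-× (∃r? S q p) (∃p? S q r))
              (⟦⟧-mono (∃r? S q p ×-dec ∃p? S q r) (box? p r) λ (x , y) → member x , member y)))

-- The coefficient of n accumulated over the rounds: each costs h times the κ n removed triples and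
-- raises κ to `κ * 2 ^ κ`.
rsConst : (h fuel κ : ℕ) → ℕ
rsConst h zero       κ = 0
rsConst h (suc fuel) κ = rsConst h fuel (κ * 2 ^ κ) + h * κ

-- The fuel bounds the occupied area in units of n²/h³. While h times the size exceeds 3 n², the
-- boxes take at least one unit per round; with no fuel left the area is 0 and no triple remains.
refine-until-sparse : ∀ h′ fuel {n κ} (S : System n) (c d : Fin n → Fin κ) → let h = suc h′ in
  h * h * h * Cells.area S c d ≤ fuel * (n * n) →
  h * size S ≤ 3 * (n * n) + rsConst h fuel κ * n
refine-until-sparse h′ zero {n} S c d small = ≤-trans (≤-reflexive (trans (cong (suc h′ *_) empty) (*-zeroʳ (suc h′)))) z≤n
  where
  open Cells S c d
  empty : size S ≡ 0
  empty = n≤0⇒n≡0 (≤-trans size≤area (≤-trans (m≤n*m area (suc h′ * suc h′ * suc h′)) small))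
refine-until-sparse h′ (suc fuel) {n} {κ} S c d small with suc h′ * size S ≤? 3 * (n * n)
... | yes done = ≤-trans done (m≤m+n _ _)
... | no ¬done = begin
  h * size S                                     ≤⟨ *-monoʳ-≤ h removed≤ ⟩
  h * (size S′ + κ * n)                          ≡⟨ *-distribˡ-+ h (size S′) (κ * n) ⟩
  h * size S′ + h * (κ * n)                      ≤⟨ +-monoˡ-≤ (h * (κ * n)) (refine-until-sparse h′ fuel S′ c′ d′ small′) ⟩
  3 * (n * n) + rsConst h fuel κ′ * n + h * (κ * n) ≡⟨ regroup (3 * (n * n)) (rsConst h fuel κ′) n h κ ⟩
  3 * (n * n) + (rsConst h fuel κ′ + h * κ) * n  ∎
  where
  h = suc h′
  open Refine S h c d
  open Cells S c d using (area)
  open ≤-Reasoning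
  regroup : ∀ a r n h κ → a + r * n + h * (κ * n) ≡ a + (r + h * κ) * n
  regroup = solve-∀
  many-good : n * n ≤ h * good
  -- Of the 3 n² exceeded, the bad triples account for at most 2 n².
  many-good = +-cancelʳ-≤ (2 * (n * n)) (n * n) (h * good) (≤-trans (<⇒≤ (≰⇒> ¬done)) mostly-good)
  gain : n * n ≤ h * h * h * box
  gain = ≤-trans many-good (≤-trans (*-monoʳ-≤ h box-large) (≤-reflexive (assoc h box)))
    where
    assoc : ∀ h b → h * (h * h * b) ≡ h * h * h * b
    assoc = solve-∀
  small′ : h * h * h * C′.area ≤ fuel * (n * n)
  small′ = +-cancelˡ-≤ (n * n) (h * h * h * C′.area) (fuel * (n * n)) (begin
    n * n + h * h * h * C′.area           ≤⟨ +-monoˡ-≤ (h * h * h * C′.area) gain ⟩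
    h * h * h * box + h * h * h * C′.area ≡⟨ trans (sym (*-distribˡ-+ (h * h * h) box C′.area)) (cong (h * h * h *_) (+-comm box C′.area)) ⟩
    h * h * h * (C′.area + box)           ≤⟨ *-monoʳ-≤ (h * h * h) area-drop ⟩
    h * h * h * area                      ≤⟨ small ⟩
    n * n + fuel * (n * n)                ∎)

ruzsa-szemerédi : ∀ h′ {n} (S : System n) → let h = suc h′ in
  h * size S ≤ 3 * (n * n) + rsConst h (h * h * h) 1 * n
-- With one class on either side the area is at most n², that is, h³ units of n²/h³.
ruzsa-szemerédi h′ {n} S = refine-until-sparse h′ (h * h * h) S (λ _ → zero {0}) (λ _ → zero {0}) (*-monoʳ-≤ (h * h * h)
  (∑-bound λ p → ≤-trans (∑-bound λ r → ⟦⟧≤1 (Cells.occupied? S (λ _ → zero {0}) (λ _ → zero {0}) p r)) (≤-reflexive (*-identityʳ n))))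
  where h = suc h′

-- Pairs with two common neighbours

rearrangement : ∀ {a b q q′} → a ≤ b → q′ ≤ q → q * a + q′ * b ≤ q * b + q′ * a
rearrangement {a} {q′ = q′} a≤b q′≤q with y , refl ← m≤n⇒∃[o]m+o≡n a≤b | x , refl ← m≤n⇒∃[o]m+o≡n q′≤q =
  ≤-trans (m≤m+n _ (x * y)) (≤-reflexive (identity a q′ x y))
  where
  identity : ∀ a q x y → (q + x) * a + q * (a + y) + x * y ≡ (q + x) * (a + y) + q * a
  identity = solve-∀

-- With q = W/a and q′ = W/b this is a/b + b/a ≥ 2, multiplied by W. The larger of a, b has the
-- smaller quotient, so `rearrangement` applies.
reciprocal-sum : ∀ {a b q q′ W} → 1 ≤ a → 1 ≤ b → q * a ≡ W → q′ * b ≡ W → W + W ≤ q * b + q′ * a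
reciprocal-sum {a@(suc _)} {b@(suc _)} {q} {q′} _ _ refl e with ≤-total a b
... | inj₁ a≤b = ≤-trans (+-monoʳ-≤ (q * a) (≤-reflexive (sym e))) (rearrangement a≤b
                   (*-cancelʳ-≤ q′ q b (≤-trans (≤-reflexive e) (*-monoʳ-≤ q a≤b))))
... | inj₂ b≤a = ≤-trans (≤-trans (+-monoˡ-≤ (q * a) (≤-reflexive (sym e))) (rearrangement b≤a
                   (*-cancelʳ-≤ q q′ a (≤-trans (≤-reflexive (sym e)) (*-monoʳ-≤ q′ b≤a)))))
                   (≤-reflexive (+-comm (q′ * a) (q * b)))

d∣n! : ∀ {d n} → 1 ≤ d → d ≤ n → d ∣ n !
d∣n! {suc d} _ d≤n = ∣-trans (m∣m*n (d !)) (m≤n⇒m!∣n! d≤n)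

module CommonNeighbours {n : ℕ} {H : Fin n → Fin n → Set} (H? : ∀ i j → Dec (H i j)) where

  deg : Fin n → ℕ
  deg i = ∑[ j < n ] ⟦ H? i j ⟧

  codeg : Fin n → Fin n → ℕ
  codeg i j = ∑[ k < n ] ⟦ H? i k ×-dec H? k j ⟧

  multi? : ∀ i j → Dec (2 ≤ codeg i j)
  multi? i j = 2 ≤? codeg i j

  multis : Fin n → ℕ
  multis i = ∑[ j < n ] ⟦ multi? i j ⟧

  -- Group the 2-walks from i by their endpoint j: there are at most `deg i` of them if j counts in
  -- `multis i`, and otherwise at most one.
  two-paths : ∀ i → ∑[ k < n ] (⟦ H? i k ⟧ * deg k) ≤ deg i * multis i + n
  two-paths i = begin
    ∑[ k < n ] (⟦ H? i k ⟧ * deg k)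
      ≡⟨ sum-cong-≗ (λ k → *-distribˡ-sum ⟦ H? i k ⟧ (λ j → ⟦ H? k j ⟧)) ⟩
    ∑[ k < n ] ∑[ j < n ] (⟦ H? i k ⟧ * ⟦ H? k j ⟧)
      ≤⟨ ∑∑-mono (λ k j → ⟦⟧-× (H? i k) (H? k j)) ⟩
    ∑[ k < n ] ∑[ j < n ] ⟦ H? i k ×-dec H? k j ⟧
      ≡⟨ ∑-comm (λ k j → ⟦ H? i k ×-dec H? k j ⟧) ⟩
    ∑[ j < n ] codeg i j
      ≤⟨ ∑-mono codeg≤ ⟩
    ∑[ j < n ] (deg i * ⟦ multi? i j ⟧ + 1)
      ≡⟨ ∑-distrib-+ {n} _ _ ⟩
    ∑[ j < n ] (deg i * ⟦ multi? i j ⟧) + ∑[ j < n ] 1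
      ≡⟨ cong₂ _+_ (sym (*-distribˡ-sum {n} (deg i) _)) (trans (∑-const n 1) (*-identityʳ n)) ⟩
    deg i * multis i + n ∎
    where
    open ≤-Reasoning
    codeg≤deg : ∀ j → codeg i j ≤ deg i
    codeg≤deg j = ∑-mono λ k → ⟦⟧-mono (H? i k ×-dec H? k j) (H? i k) proj₁
    codeg≤ : ∀ j → codeg i j ≤ deg i * ⟦ multi? i j ⟧ + 1
    codeg≤ j = case (multi? i j)
      where
      case : Dec (2 ≤ codeg i j) → codeg i j ≤ deg i * ⟦ multi? i j ⟧ + 1
      case (yes m) = ≤-trans (codeg≤deg j) (≤-trans (≤-reflexive (sym (trans (cong (deg i *_) (⟦⟧-true (multi? i j) m)) (*-identityʳ _)))) (m≤m+n _ _))
      case (no ¬m) = ≤-trans (s≤s⁻¹ (≰⇒> ¬m)) (m≤n+m 1 _)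

  module Cutoff (H-sym : ∀ {i j} → H i j → H j i) (L : ℕ) (L≥1 : 1 ≤ L) where

    big? : ∀ i → Dec (L ≤ deg i)
    big? i = L ≤? deg i

    -- The integer n!/deg i plays the role of 1/deg i; vertices of small degree get 0.
    weight-data : ∀ i → Dec (L ≤ deg i) → ∃ λ w → (L ≤ deg i → w * deg i ≡ n !) × (¬ L ≤ deg i → w ≡ 0)
    weight-data i (yes b) = quotient deg∣n! , (λ _ → sym (_∣_.equality deg∣n!)) , contradiction b
      where
      deg∣n! : deg i ∣ n !
      deg∣n! = d∣n! (≤-trans L≥1 b) (≤-trans (∑-bound λ j → ⟦⟧≤1 (H? i j)) (≤-reflexive (*-identityʳ n)))
    weight-data i (no ¬b) = 0 , (λ b → contradiction b ¬b) , λ _ → refl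

    weight : Fin n → ℕ
    weight i = proj₁ (weight-data i (big? i))

    weight-big : ∀ i → L ≤ deg i → weight i * deg i ≡ n !
    weight-big i = proj₁ (proj₂ (weight-data i (big? i)))

    weight-small : ∀ i → ¬ L ≤ deg i → weight i ≡ 0
    weight-small i = proj₂ (proj₂ (weight-data i (big? i)))

    weight*deg≤ : ∀ i → weight i * deg i ≤ n !
    weight*deg≤ i = case (big? i)
      where
      case : Dec (L ≤ deg i) → weight i * deg i ≤ n !
      case (yes b) = ≤-reflexive (weight-big i b)
      case (no ¬b) = ≤-trans (≤-reflexive (cong (_* deg i) (weight-small i ¬b))) z≤n

    L*weight≤ : ∀ i → L * weight i ≤ n !
    L*weight≤ i = case (big? i)
      where
      case : Dec (L ≤ deg i) → L * weight i ≤ n !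
      case (yes b) = ≤-trans (*-monoˡ-≤ (weight i) b) (≤-trans (≤-reflexive (*-comm (deg i) (weight i))) (weight*deg≤ i))
      case (no ¬b) = ≤-trans (≤-reflexive (trans (cong (L *_) (weight-small i ¬b)) (*-zeroʳ L))) z≤n

    weighted : ℕ
    weighted = ∑[ i < n ] ∑[ k < n ] (⟦ H? i k ⟧ * (weight i * deg k))

    -- Dividing `two-paths` by `deg i` gives `multis i` plus n / `deg i`, and the cutoff bounds the
    -- last term by n/L. Everything is multiplied by L and n! to stay in the integers.
    weighted≤ : L * weighted ≤ n ! * (L * ∑[ i < n ] multis i + n * n)
    weighted≤ = begin
      L * weighted
        ≡⟨ cong (L *_) (sum-cong-≗ λ i → trans (sum-cong-≗ λ k → swap ⟦ H? i k ⟧ (weight i) (deg k)) (sym (*-distribˡ-sum {n} (weight i) _))) ⟩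
      L * ∑[ i < n ] (weight i * ∑[ k < n ] (⟦ H? i k ⟧ * deg k))
        ≡⟨ *-distribˡ-sum {n} L _ ⟩
      ∑[ i < n ] (L * (weight i * ∑[ k < n ] (⟦ H? i k ⟧ * deg k)))
        ≤⟨ ∑-mono row ⟩
      ∑[ i < n ] (n ! * (L * multis i + n))
        ≡⟨ *-distribˡ-sum {n} (n !) _ ⟨
      n ! * ∑[ i < n ] (L * multis i + n)
        ≡⟨ cong (n ! *_) (trans (∑-distrib-+ {n} _ _) (cong₂ _+_ (sym (*-distribˡ-sum {n} L multis)) (∑-const n n))) ⟩
      n ! * (L * ∑[ i < n ] multis i + n * n) ∎
      where
      open ≤-Reasoning
      swap : ∀ x w d → x * (w * d) ≡ w * (x * d)
      swap = solve-∀
      expand : ∀ L w d m n → L * (w * (d * m + n)) ≡ (w * d) * (L * m) + (L * w) * n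
      expand = solve-∀
      row : ∀ i → L * (weight i * ∑[ k < n ] (⟦ H? i k ⟧ * deg k)) ≤ n ! * (L * multis i + n)
      row i = begin
        L * (weight i * ∑[ k < n ] (⟦ H? i k ⟧ * deg k)) ≤⟨ *-monoʳ-≤ L (*-monoʳ-≤ (weight i) (two-paths i)) ⟩
        L * (weight i * (deg i * multis i + n))          ≡⟨ expand L (weight i) (deg i) (multis i) n ⟩
        weight i * deg i * (L * multis i) + L * weight i * n
          ≤⟨ +-mono-≤ (*-monoˡ-≤ (L * multis i) (weight*deg≤ i)) (*-monoˡ-≤ n (L*weight≤ i)) ⟩
        n ! * (L * multis i) + n ! * n                   ≡⟨ *-distribˡ-+ (n !) (L * multis i) n ⟨
        n ! * (L * multis i + n) ∎

    core? : ∀ i k → Dec (H i k × L ≤ deg i × L ≤ deg k)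
    core? i k = H? i k ×-dec big? i ×-dec big? k

    core : ℕ
    core = ∑[ i < n ] ∑[ k < n ] ⟦ core? i k ⟧

    -- The two orientations of an edge together contribute n! times d/d′ + d′/d ≥ 2, where d, d′ are
    -- the degrees of its ends.
    core≤weighted : n ! * core ≤ weighted
    core≤weighted = *-cancelˡ-≤ 2 (begin
      2 * (n ! * core)
        ≡⟨ trans (sym (*-assoc 2 (n !) core)) (*-∑∑ {n} {n} (2 * n !) _) ⟩
      ∑[ i < n ] ∑[ k < n ] (2 * n ! * ⟦ core? i k ⟧)
        ≤⟨ ∑∑-mono pair ⟩
      ∑[ i < n ] ∑[ k < n ] (⟦ H? i k ⟧ * (weight i * deg k) + ⟦ H? k i ⟧ * (weight k * deg i))
        ≡⟨ ∑∑-distrib-+ {n} {n} (λ i k → ⟦ H? i k ⟧ * (weight i * deg k)) _ ⟩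
      weighted + ∑[ i < n ] ∑[ k < n ] (⟦ H? k i ⟧ * (weight k * deg i))
        ≡⟨ cong (weighted +_) (∑-comm λ i k → ⟦ H? k i ⟧ * (weight k * deg i)) ⟩
      weighted + weighted
        ≡⟨ cong (weighted +_) (+-identityʳ weighted) ⟨
      2 * weighted ∎)
      where
      open ≤-Reasoning
      pair : ∀ i k → 2 * n ! * ⟦ core? i k ⟧ ≤ ⟦ H? i k ⟧ * (weight i * deg k) + ⟦ H? k i ⟧ * (weight k * deg i)
      pair i k = case (core? i k)
        where
        case : Dec (H i k × L ≤ deg i × L ≤ deg k) → 2 * n ! * ⟦ core? i k ⟧ ≤ ⟦ H? i k ⟧ * (weight i * deg k) + ⟦ H? k i ⟧ * (weight k * deg i)
        case (no ¬c) = ≤-trans (≤-reflexive (trans (cong (2 * n ! *_) (⟦⟧-false (core? i k) ¬c)) (*-zeroʳ (2 * n !)))) z≤n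
        case (yes (a , b , b′)) = begin
          2 * n ! * ⟦ core? i k ⟧ ≤⟨ *-monoʳ-≤ (2 * n !) (⟦⟧≤1 (core? i k)) ⟩
          2 * n ! * 1             ≡⟨ trans (*-identityʳ (2 * n !)) (cong (n ! +_) (+-identityʳ (n !))) ⟩
          n ! + n !               ≤⟨ reciprocal-sum {q = weight i} {q′ = weight k} (≤-trans L≥1 b) (≤-trans L≥1 b′) (weight-big i b) (weight-big k b′) ⟩
          weight i * deg k + weight k * deg i
            ≡⟨ cong₂ _+_ (one (H? i k) a) (one (H? k i) (H-sym a)) ⟩
          ⟦ H? i k ⟧ * (weight i * deg k) + ⟦ H? k i ⟧ * (weight k * deg i) ∎
          where
          one : ∀ {P : Set} (p : Dec P) → P → ∀ {x} → x ≡ ⟦ p ⟧ * x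
          one p x = sym (trans (cong (_* _) (⟦⟧-true p x)) (*-identityˡ _))

    -- A pair outside the core has an end of degree below L. Each vertex is such an end for at most
    -- L pairs in either orientation.
    degrees≤core : ∑[ i < n ] deg i ≤ core + 2 * (n * L)
    degrees≤core = begin
      ∑[ i < n ] deg i
        ≤⟨ ∑∑-mono split ⟩
      ∑[ i < n ] ∑[ k < n ] (⟦ core? i k ⟧ + (⟦ small? i k ⟧ + ⟦ small? k i ⟧))
        ≡⟨ trans (∑∑-distrib-+ {n} {n} _ _) (cong (core +_) (∑∑-distrib-+ {n} {n} _ _)) ⟩
      core + (smalls + ∑[ i < n ] ∑[ k < n ] ⟦ small? k i ⟧)
        ≡⟨ cong (λ z → core + (smalls + z)) (trans (∑-comm λ i k → ⟦ small? k i ⟧) (sym (+-identityʳ smalls))) ⟩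
      core + 2 * smalls
        ≤⟨ +-monoʳ-≤ core (*-monoʳ-≤ 2 (∑-bound row)) ⟩
      core + 2 * (n * L) ∎
      where
      open ≤-Reasoning
      small? : ∀ i k → Dec (H i k × ¬ L ≤ deg i)
      small? i k = H? i k ×-dec ¬? (big? i)
      smalls : ℕ
      smalls = ∑[ i < n ] ∑[ k < n ] ⟦ small? i k ⟧
      split : ∀ i k → ⟦ H? i k ⟧ ≤ ⟦ core? i k ⟧ + (⟦ small? i k ⟧ + ⟦ small? k i ⟧)
      split i k = ⟦⟧-bound (H? i k) λ x → case x (big? i) (big? k)
        where
        case : H i k → Dec (L ≤ deg i) → Dec (L ≤ deg k) → 1 ≤ ⟦ core? i k ⟧ + (⟦ small? i k ⟧ + ⟦ small? k i ⟧)
        case x (yes b) (yes b′) = ≤-trans (⟦⟧-pos (core? i k) (x , b , b′)) (m≤m+n _ _)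
        case x (no ¬b) _        = ≤-trans (≤-trans (⟦⟧-pos (small? i k) (x , ¬b)) (m≤m+n _ _)) (m≤n+m _ ⟦ core? i k ⟧)
        case x (yes _) (no ¬b)  = ≤-trans (≤-trans (⟦⟧-pos (small? k i) (H-sym x , ¬b)) (m≤n+m _ ⟦ small? i k ⟧)) (m≤n+m _ ⟦ core? i k ⟧)
      row : ∀ i → ∑[ k < n ] ⟦ small? i k ⟧ ≤ L
      row i = case (big? i)
        where
        case : Dec (L ≤ deg i) → ∑[ k < n ] ⟦ small? i k ⟧ ≤ L
        case (yes b) = ≤-trans (≤-reflexive (∑-zero λ k → ⟦⟧-false (small? i k) λ (_ , ¬b) → ¬b b)) z≤n
        case (no ¬b) = ≤-trans (∑-mono λ k → ⟦⟧-mono (small? i k) (H? i k) proj₁) (<⇒≤ (≰⇒> ¬b))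

    degrees≤multis : L * ∑[ i < n ] deg i ≤ L * ∑[ i < n ] multis i + (n * n + L * (2 * (n * L)))
    degrees≤multis = begin
      L * ∑[ i < n ] deg i
        ≤⟨ *-monoʳ-≤ L degrees≤core ⟩
      L * (core + 2 * (n * L))
        ≡⟨ *-distribˡ-+ L core (2 * (n * L)) ⟩
      L * core + L * (2 * (n * L))
        ≤⟨ +-monoˡ-≤ (L * (2 * (n * L))) core-bound ⟩
      L * ∑[ i < n ] multis i + n * n + L * (2 * (n * L))
        ≡⟨ +-assoc (L * ∑[ i < n ] multis i) (n * n) (L * (2 * (n * L))) ⟩
      L * ∑[ i < n ] multis i + (n * n + L * (2 * (n * L))) ∎
      where
      open ≤-Reasoning
      instance
        n!≢0 : NonZero (n !)
        n!≢0 = >-nonZero (1≤n! n)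
      core-bound : L * core ≤ L * ∑[ i < n ] multis i + n * n
      core-bound = *-cancelˡ-≤ (n !) (begin
        n ! * (L * core) ≡⟨ swap (n !) L core ⟩
        L * (n ! * core) ≤⟨ *-monoʳ-≤ L core≤weighted ⟩
        L * weighted     ≤⟨ weighted≤ ⟩
        n ! * (L * ∑[ i < n ] multis i + n * n) ∎)
        where
        swap : ∀ a b c → a * (b * c) ≡ b * (a * c)
        swap = solve-∀

-- Roles of critical edges

module Roles {n : ℕ} (G : Graph n) where

  A : Fin n → Fin n → Set
  A x y = adj G x y ≡ true

  A? : ∀ x y → Dec (A x y)
  A? x y = adj G x y ≟ᵇ true

  A-sym : ∀ {x y} → A x y → A y x
  A-sym {x} {y} e = trans (Graph.sym G y x) e

  A-irr : ∀ {x} → ¬ A x x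
  A-irr {x} e with () ← trans (sym (Graph.irrefl G x)) e

  record Cherry (x w y : Fin n) : Set where
    field
      xw     : A x w
      wy     : A w y
      x≢y    : x ≢ y
      ¬xy    : ¬ A x y
      unique : ∀ p → A x p → A p y → p ≡ w

  record Two (x w y : Fin n) : Set where
    field
      cherry     : Cherry x w y
      triangle-free : ∀ c → A x c → ¬ A c w

  record Far (x y : Fin n) : Set where
    field
      x≢y : x ≢ y
      ¬xy : ¬ A x y
      ¬common : ∀ p → A x p → ¬ A p y

  record Path (x a b y : Fin n) : Set where
    field
      far : Far x y
      xa  : A x a
      ab  : A a b
      by  : A b y

  -- Deleting xa blocks all walks of length 3 from x to y, so they all begin with xa, but their
  -- third vertex may vary. In `Mid` the deleted edge fixes both inner vertices.
  record First (x a b y : Fin n) : Set where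
    field
      path   : Path x a b y
      forced : ∀ p q → A x p → A p q → A q y → p ≡ a

  record Mid (x a b y : Fin n) : Set where
    field
      path   : Path x a b y
      forced : ∀ p q → A x p → A p q → A q y → p ≡ a × q ≡ b

  Far-sym : ∀ {x y} → Far x y → Far y x
  Far-sym f = record { x≢y = λ e → x≢y (sym e) ; ¬xy = λ e → ¬xy (A-sym e)
                     ; ¬common = λ p yp px → ¬common p (A-sym px) (A-sym yp) }
    where
    open Far f

  Path-sym : ∀ {x a b y} → Path x a b y → Path y b a x
  Path-sym P = record { far = Far-sym far ; xa = A-sym by ; ab = A-sym ab ; by = A-sym xa }
    where
    open Path P

  Mid-sym : ∀ {x a b y} → Mid x a b y → Mid y b a x
  Mid-sym M = record { path = Path-sym path
                     ; forced = λ p q yp pq qx → let e , f = forced q p (A-sym qx) (A-sym pq) (A-sym yp) in f , e }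
    where
    open Mid M

  -- A second common neighbour of x and b would extend by the edge by to a walk of length 3 that
  -- avoids a.
  First⇒Cherry : ∀ {x a b y} → First x a b y → Cherry x a b
  First⇒Cherry F = record { xw = xa ; wy = ab ; x≢y = λ { refl → ¬xy by } ; ¬xy = λ xb → ¬common _ xb by
                          ; unique = λ p xp pb → forced p _ xp pb by }
    where
    open First F
    open Path path
    open Far far using (¬xy; ¬common)

  Mid⇒Cherry : ∀ {x a b y} → Mid x a b y → Cherry a b y
  Mid⇒Cherry M = record { xw = ab ; wy = by ; x≢y = λ { refl → ¬xy xa } ; ¬xy = λ ay → ¬common _ xa ay
                        ; unique = λ p ap py → proj₂ (forced _ p xa ap py) }
    where
    open Mid M
    open Path path
    open Far far using (¬xy; ¬common)

  -- The arguments complete the edge uv to the path of Justified below; a prime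
  -- exchanges u and v, and off is the junk value for nonadjacent u, v.
  data Role (u v : Fin n) : Set where
    two two′ : (y : Fin n) → Role u v
    end end′ : (b y : Fin n) → Role u v
    mid : (x y : Fin n) → Role u v
    off : Role u v

  -- Critical pairs and the walks they block

  Same : Fin n → Fin n → Fin n → Fin n → Set
  Same u v a b = (a ≡ u × b ≡ v) ⊎ (a ≡ v × b ≡ u)

  same? : ∀ u v a b → Dec (Same u v a b)
  same? u v a b = (a ≟ᶠ u ×-dec b ≟ᶠ v) ⊎-dec (a ≟ᶠ v ×-dec b ≟ᶠ u)

  kept : ∀ {u v a b} → A a b → ¬ Same u v a b → removeEdge (adj G) u v a b ≡ true
  kept {u} {v} {a} {b} e ¬s with adj G a b | a ≟ᶠ u | b ≟ᶠ v | a ≟ᶠ v | b ≟ᶠ u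
  ... | true | yes p | yes q | _     | _     = contradiction (inj₁ (p , q)) ¬s
  ... | true | yes _ | no _  | yes p | yes q = contradiction (inj₂ (p , q)) ¬s
  ... | true | no _  | _     | yes p | yes q = contradiction (inj₂ (p , q)) ¬s
  ... | true | yes _ | no _  | yes _ | no _  = refl
  ... | true | yes _ | no _  | no _  | _     = refl
  ... | true | no _  | _     | yes _ | no _  = refl
  ... | true | no _  | _     | no _  | _     = refl

  -- The distance condition on the graph without uv, read positively: every walk from x to y of
  -- length at most 3 uses uv, with one field for each length.
  record Blocks (u v x y : Fin n) : Set where
    field
      x≢y : x ≢ y
      hit₁ : A x y → Same u v x y
      hit₂ : ∀ p → A x p → A p y → Same u v x p ⊎ Same u v p y
      hit₃ : ∀ p q → A x p → A p q → A q y → Same u v x p ⊎ Same u v p q ⊎ Same u v q y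

  Same-flip : ∀ {u v a b} → Same u v a b → Same u v b a
  Same-flip (inj₁ (p , q)) = inj₂ (q , p)
  Same-flip (inj₂ (p , q)) = inj₁ (q , p)

  Same-swap : ∀ {u v a b} → Same u v a b → Same v u a b
  Same-swap (inj₁ s) = inj₂ s
  Same-swap (inj₂ s) = inj₁ s

  Blocks-flip : ∀ {u v x y} → Blocks u v x y → Blocks u v y x
  Blocks-flip B = record
    { x≢y = λ e → x≢y (sym e)
    ; hit₁ = λ e → Same-flip (hit₁ (A-sym e))
    ; hit₂ = λ p yp px → [ (λ s → inj₂ (Same-flip s)) , (λ s → inj₁ (Same-flip s)) ] (hit₂ p (A-sym px) (A-sym yp))
    ; hit₃ = λ p q yp pq qx →
        [ (λ s → inj₂ (inj₂ (Same-flip s)))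
        , [ (λ s → inj₂ (inj₁ (Same-flip s))) , (λ s → inj₁ (Same-flip s)) ] ]
        (hit₃ q p (A-sym qx) (A-sym pq) (A-sym yp)) }
    where
    open Blocks B

  Blocks-swap : ∀ {u v x y} → Blocks u v x y → Blocks v u x y
  Blocks-swap B = record
    { x≢y = x≢y
    ; hit₁ = λ e → Same-swap (hit₁ e)
    ; hit₂ = λ p a b → [ (λ s → inj₁ (Same-swap s)) , (λ s → inj₂ (Same-swap s)) ] (hit₂ p a b)
    ; hit₃ = λ p q a b c → [ (λ s → inj₁ (Same-swap s)) , [ (λ s → inj₂ (inj₁ (Same-swap s))) , (λ s → inj₂ (inj₂ (Same-swap s))) ] ]
                             (hit₃ p q a b c) }
    where
    open Blocks B

  blocks : ∀ {u v x y} → ¬ Within (removeEdge (adj G) u v) 3 x y → Blocks u v x y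
  blocks {u} {v} {x} {y} ¬w = record
    { x≢y = λ { refl → ¬w here }
    ; hit₁ = λ xy → case₁ xy (same? u v x y)
    ; hit₂ = λ p xp py → case₂ xp py (same? u v x p) (same? u v p y)
    ; hit₃ = λ p q xp pq qy → case₃ xp pq qy (same? u v x p) (same? u v p q) (same? u v q y) }
    where
    case₁ : A x y → Dec (Same u v x y) → Same u v x y
    case₁ _  (yes s) = s
    case₁ xy (no ¬s) = ⊥-elim (¬w (step (kept xy ¬s) here))
    case₂ : ∀ {p} → A x p → A p y → Dec (Same u v x p) → Dec (Same u v p y) → Same u v x p ⊎ Same u v p y
    case₂ _  _  (yes s) _       = inj₁ s
    case₂ _  _  (no _)  (yes s) = inj₂ s
    case₂ xp py (no ¬s) (no ¬t) = ⊥-elim (¬w (step (kept xp ¬s) (step (kept py ¬t) here)))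
    case₃ : ∀ {p q} → A x p → A p q → A q y → Dec (Same u v x p) → Dec (Same u v p q) → Dec (Same u v q y) →
            Same u v x p ⊎ Same u v p q ⊎ Same u v q y
    case₃ _  _  _  (yes s) _       _       = inj₁ s
    case₃ _  _  _  (no _)  (yes s) _       = inj₂ (inj₁ s)
    case₃ _  _  _  (no _)  (no _)  (yes s) = inj₂ (inj₂ s)
    case₃ xp pq qy (no ¬s) (no ¬t) (no ¬r) = ⊥-elim (¬w (step (kept xp ¬s) (step (kept pq ¬t) (step (kept qy ¬r) here))))

  -- A second common neighbour p gives the walk x p y, and a triangle x c w gives the walk x c w y;
  -- neither uses xw.
  blocks-two : ∀ {x w y} → Blocks x w x y → A x w → A w y → ¬ A x y → Two x w y
  blocks-two {x} {w} {y} B xw wy ¬xy = record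
    { cherry = record { xw = xw ; wy = wy ; x≢y = x≢y ; ¬xy = ¬xy ; unique = unique }
    ; triangle-free = triangle-free }
    where
    open Blocks B
    unique : ∀ p → A x p → A p y → p ≡ w
    unique p xp py with hit₂ p xp py
    ... | inj₁ (inj₁ (_ , e))       = e
    ... | inj₁ (inj₂ (_ , refl))    = contradiction xp A-irr
    ... | inj₂ (inj₁ (refl , refl)) = contradiction xp A-irr
    ... | inj₂ (inj₂ (e , _))       = e
    triangle-free : ∀ c → A x c → ¬ A c w
    triangle-free c xc cw with hit₃ c w xc cw wy
    ... | inj₁ (inj₁ (_ , refl))           = A-irr cw
    ... | inj₁ (inj₂ (_ , refl))           = A-irr xc
    ... | inj₂ (inj₁ (inj₁ (refl , _)))    = A-irr xc
    ... | inj₂ (inj₁ (inj₂ (refl , _)))    = A-irr cw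
    ... | inj₂ (inj₂ (inj₁ (refl , _)))    = A-irr xw
    ... | inj₂ (inj₂ (inj₂ (_ , refl)))    = x≢y refl

  -- Any other position of xa on a walk would create a loop or contradict the distance of x and y.
  blocks-first : ∀ {x a b y} → Blocks x a x y → Path x a b y → First x a b y
  blocks-first {x} {a} {b} {y} B P = record { path = P ; forced = forced }
    where
    open Blocks B using (hit₃)
    open Path P
    open Far far
    forced : ∀ p q → A x p → A p q → A q y → p ≡ a
    forced p q xp pq qy with hit₃ p q xp pq qy
    ... | inj₁ (inj₁ (_ , e))           = e
    ... | inj₁ (inj₂ (_ , refl))        = contradiction xp A-irr
    ... | inj₂ (inj₁ (inj₁ (refl , _))) = contradiction xp A-irr
    ... | inj₂ (inj₁ (inj₂ (e , _)))    = e
    ... | inj₂ (inj₂ (inj₁ (refl , _))) = contradiction qy ¬xy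
    ... | inj₂ (inj₂ (inj₂ (_ , refl))) = contradiction refl x≢y

  blocks-mid : ∀ {x a b y} → Blocks a b x y → Path x a b y → Mid x a b y
  blocks-mid {x} {a} {b} {y} B P = record { path = P ; forced = forced }
    where
    open Blocks B using (hit₃)
    open Path P
    open Far far
    forced : ∀ p q → A x p → A p q → A q y → p ≡ a × q ≡ b
    forced p q xp pq qy with hit₃ p q xp pq qy
    ... | inj₁ (inj₁ (refl , _))           = contradiction xa A-irr
    ... | inj₁ (inj₂ (refl , _))           = contradiction by ¬xy
    ... | inj₂ (inj₁ (inj₁ (e , f)))       = e , f
    ... | inj₂ (inj₁ (inj₂ (refl , refl))) = contradiction by (¬common _ xp)
    ... | inj₂ (inj₂ (inj₁ (_ , refl)))    = contradiction by A-irr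
    ... | inj₂ (inj₂ (inj₂ (_ , refl)))    = contradiction xa ¬xy

  -- The edge uv is its own critical pair, so it lies on no cycle of length 3 or 4.
  module LightEdge {u v} (B : Blocks u v u v) (uv : A u v) where
    open Blocks B

    no-triangle : ∀ c → A u c → ¬ A c v
    no-triangle c uc cv with hit₂ c uc cv
    ... | inj₁ (inj₁ (_ , refl)) = A-irr cv
    ... | inj₁ (inj₂ (_ , refl)) = A-irr uc
    ... | inj₂ (inj₁ (refl , _)) = A-irr uc
    ... | inj₂ (inj₂ (refl , _)) = A-irr cv

    no-square : ∀ p q → A u p → A p q → A q v → p ≡ v ⊎ q ≡ u
    no-square p q up pq qv with hit₃ p q up pq qv
    ... | inj₁ (inj₁ (_ , e))           = inj₁ e
    ... | inj₁ (inj₂ (_ , refl))        = contradiction up A-irr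
    ... | inj₂ (inj₁ (inj₁ (refl , _))) = contradiction up A-irr
    ... | inj₂ (inj₁ (inj₂ (e , _)))    = inj₁ e
    ... | inj₂ (inj₂ (inj₁ (e , _)))    = inj₂ e
    ... | inj₂ (inj₂ (inj₂ (refl , _))) = contradiction qv A-irr

    light-two : ∀ {c} → A v c → c ≢ u → Two u v c
    light-two {c} vc c≢u = record
      { cherry = record { xw = uv ; wy = vc ; x≢y = λ e → c≢u (sym e) ; ¬xy = λ uc → no-triangle c uc (A-sym vc)
                        ; unique = λ p up pc → [ (λ e → e) , (λ e → contradiction e c≢u) ] (no-square p c up pc (A-sym vc)) }
      ; triangle-free = no-triangle }

  closed-pair : ∀ {u v} → (∀ c → A v c → c ≡ u) → (∀ c → A u c → c ≡ v) →
                ∀ {k a z} → Within (adj G) k a z → a ≡ u ⊎ a ≡ v → z ≡ u ⊎ z ≡ v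
  closed-pair f g here       a∈          = a∈
  closed-pair f g (step e w) (inj₁ refl) = closed-pair f g w (inj₂ (g _ e))
  closed-pair f g (step e w) (inj₂ refl) = closed-pair f g w (inj₁ (f _ e))

  Justified : ∀ {u v} → Role u v → Set
  Justified {u} {v} (two y)    = Two u v y
  Justified {u} {v} (two′ y)   = Two v u y
  Justified {u} {v} (end b y)  = First u v b y
  Justified {u} {v} (end′ b y) = First v u b y
  Justified {u} {v} (mid x y)  = Mid x u v y
  Justified off                = ⊥

  JustifiedRole : Fin n → Fin n → Set
  JustifiedRole u v = ∃ λ (ρ : Role u v) → Justified ρ

  module Classify (diam : Diam3 (adj G)) where

    light-role : ∀ {u v} → Blocks u v u v → A u v → JustifiedRole u v
    light-role {u} {v} B uv with any? (λ c → A? v c ×-dec ¬? (c ≟ᶠ u)) | any? (λ c → A? u c ×-dec ¬? (c ≟ᶠ v))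
    ... | yes (c , vc , c≢u) | _ = two c , LightEdge.light-two B uv vc c≢u
    ... | no _ | yes (c , uc , c≢v) = two′ c , LightEdge.light-two (Blocks-flip (Blocks-swap B)) (A-sym uv) uc c≢v
    -- If neither end has another neighbour, connectivity makes u and v the whole graph, and no two
    -- vertices are more than 2 apart.
    ... | no ¬v | no ¬u = ⊥-elim (isolated (stay (proj₁ (proj₂ diam))) (stay (proj₁ (proj₂ (proj₂ diam)))) (proj₂ (proj₂ (proj₂ diam))))
      where
      only : ∀ {a b} → ¬ (∃ λ c → A a c × ¬ c ≡ b) → ∀ c → A a c → c ≡ b
      only {b = b} ¬∃ c ac with c ≟ᶠ b
      ... | yes e = e
      ... | no ¬e = contradiction (c , ac , ¬e) ¬∃
      stay : ∀ z → z ≡ u ⊎ z ≡ v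
      stay z = closed-pair (only ¬v) (only ¬u) (proj₁ diam u z) (inj₁ refl)
      isolated : ∀ {x y} → x ≡ u ⊎ x ≡ v → y ≡ u ⊎ y ≡ v → ¬ Within (adj G) 2 x y → ⊥
      isolated (inj₁ refl) (inj₁ refl) ¬w = ¬w here
      isolated (inj₁ refl) (inj₂ refl) ¬w = ¬w (step uv here)
      isolated (inj₂ refl) (inj₁ refl) ¬w = ¬w (step (A-sym uv) here)
      isolated (inj₂ refl) (inj₂ refl) ¬w = ¬w here

    two-role : ∀ {u v x w y} → Blocks u v x y → A x w → A w y → ¬ A x y → JustifiedRole u v
    two-role {u} {v} {x} {w} {y} B xw wy ¬xy with Blocks.hit₂ B w xw wy
    ... | inj₁ (inj₁ (refl , refl)) = two y , blocks-two B xw wy ¬xy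
    ... | inj₁ (inj₂ (refl , refl)) = two′ y , blocks-two (Blocks-swap B) xw wy ¬xy
    ... | inj₂ (inj₁ (refl , refl)) = two′ x , blocks-two (Blocks-flip (Blocks-swap B)) (A-sym wy) (A-sym xw) λ e → ¬xy (A-sym e)
    ... | inj₂ (inj₂ (refl , refl)) = two x , blocks-two (Blocks-flip B) (A-sym wy) (A-sym xw) λ e → ¬xy (A-sym e)

    far-role : ∀ {u v x a b y} → Blocks u v x y → Path x a b y → JustifiedRole u v
    far-role {u} {v} {x} {a} {b} {y} B P with Blocks.hit₃ B a b (Path.xa P) (Path.ab P) (Path.by P)
    ... | inj₁ (inj₁ (refl , refl))        = end b y , blocks-first B P
    ... | inj₁ (inj₂ (refl , refl))        = end′ b y , blocks-first (Blocks-swap B) P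
    ... | inj₂ (inj₁ (inj₁ (refl , refl))) = mid x y , blocks-mid B P
    ... | inj₂ (inj₁ (inj₂ (refl , refl))) = mid y x , Mid-sym (blocks-mid (Blocks-swap B) P)
    -- A last edge is a first edge of the reversed path.
    ... | inj₂ (inj₂ (inj₁ (refl , refl))) = end′ a x , blocks-first (Blocks-flip (Blocks-swap B)) (Path-sym P)
    ... | inj₂ (inj₂ (inj₂ (refl , refl))) = end a x , blocks-first (Blocks-flip B) (Path-sym P)

    -- Split by the distance of x and y before the deletion. At distance 1 the edge is xy itself; at
    -- distance 2 or 3 it lies on a shortest path, which for 3 comes from the diameter bound.
    critical-role : ∀ {u v x y} → A u v → Blocks u v x y → JustifiedRole u v
    critical-role {u} {v} {x} {y} uv B with A? x y
    ... | yes xy = adjacent (Blocks.hit₁ B xy) B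
      where
      adjacent : ∀ {x y} → Same u v x y → Blocks u v x y → JustifiedRole u v
      adjacent (inj₁ (refl , refl)) B = light-role B uv
      adjacent (inj₂ (refl , refl)) B = light-role (Blocks-flip B) uv
    ... | no ¬xy with any? (λ w → A? x w ×-dec A? w y)
    ... | yes (w , xw , wy) = two-role B xw wy ¬xy
    ... | no ¬w = walk (proj₁ diam x y)
      where
      far : Far x y
      far = record { x≢y = Blocks.x≢y B ; ¬xy = ¬xy ; ¬common = λ p xp py → ¬w (p , xp , py) }
      walk : Within (adj G) 3 x y → JustifiedRole u v
      walk here                                  = contradiction refl (Blocks.x≢y B)
      walk (step e here)                         = contradiction e ¬xy
      walk (step e (step f here))                = contradiction (_ , e , f) ¬w
      walk (step e (step f (step g here)))       = far-role B (record { far = far ; xa = e ; ab = f ; by = g })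

  swap : ∀ {u v} → Role u v → Role v u
  swap (two y)    = two′ y
  swap (two′ y)   = two y
  swap (end b y)  = end′ b y
  swap (end′ b y) = end b y
  swap (mid x y)  = mid y x
  swap off        = off

  swap-just : ∀ {u v} (ρ : Role u v) → Justified ρ → Justified (swap ρ)
  swap-just (two _)    j = j
  swap-just (two′ _)   j = j
  swap-just (end _ _)  j = j
  swap-just (end′ _ _) j = j
  swap-just (mid _ _)  j = Mid-sym j

-- Counting pairs


module _ {n : ℕ} where

  ∑∑-transpose : (f : Fin n → Fin n → ℕ) → ∑[ i < n ] ∑[ j < n ] f j i ≡ ∑[ i < n ] ∑[ j < n ] f i j
  ∑∑-transpose f = ∑-comm (λ i j → f j i)

  -- Edges are counted once, for i < j, and φ over ordered pairs. An edge may thus be charged to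
  -- either orientation or split between both.
  ∑<-≤ : (f φ : Fin n → Fin n → ℕ) → (∀ i j → ¬ toℕ i < toℕ j → f i j ≡ 0) →
         (∀ i j → toℕ i < toℕ j → f i j ≤ φ i j + φ j i) →
         ∑[ i < n ] ∑[ j < n ] f i j ≤ ∑[ i < n ] ∑[ j < n ] φ i j
  ∑<-≤ f φ f≡0 f≤ = begin
    ∑[ i < n ] ∑[ j < n ] f i j
      ≤⟨ ∑∑-mono upper ⟩
    ∑[ i < n ] ∑[ j < n ] (⟦ lt? i j ⟧ * φ i j + ⟦ lt? i j ⟧ * φ j i)
      ≡⟨ ∑∑-distrib-+ {n} {n} _ _ ⟩
    ∑[ i < n ] ∑[ j < n ] (⟦ lt? i j ⟧ * φ i j) + ∑[ i < n ] ∑[ j < n ] (⟦ lt? i j ⟧ * φ j i)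
      ≡⟨ cong (∑[ i < n ] ∑[ j < n ] (⟦ lt? i j ⟧ * φ i j) +_) (∑∑-transpose λ i j → ⟦ lt? j i ⟧ * φ i j) ⟩
    ∑[ i < n ] ∑[ j < n ] (⟦ lt? i j ⟧ * φ i j) + ∑[ i < n ] ∑[ j < n ] (⟦ lt? j i ⟧ * φ i j)
      ≡⟨ ∑∑-distrib-+ {n} {n} (λ i j → ⟦ lt? i j ⟧ * φ i j) _ ⟨
    ∑[ i < n ] ∑[ j < n ] (⟦ lt? i j ⟧ * φ i j + ⟦ lt? j i ⟧ * φ i j)
      ≤⟨ ∑∑-mono both ⟩
    ∑[ i < n ] ∑[ j < n ] φ i j ∎
    where
    open ≤-Reasoning
    lt? : ∀ i j → Dec (toℕ i < toℕ j)
    lt? i j = toℕ i <? toℕ j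
    upper : ∀ i j → f i j ≤ ⟦ lt? i j ⟧ * φ i j + ⟦ lt? i j ⟧ * φ j i
    upper i j = case (lt? i j)
      where
      case : Dec (toℕ i < toℕ j) → f i j ≤ ⟦ lt? i j ⟧ * φ i j + ⟦ lt? i j ⟧ * φ j i
      case (no ¬l) = ≤-trans (≤-reflexive (f≡0 i j ¬l)) z≤n
      case (yes l) = ≤-trans (f≤ i j l) (≤-reflexive (sym (cong₂ _+_ (one (φ i j)) (one (φ j i)))))
        where
        one : ∀ x → ⟦ lt? i j ⟧ * x ≡ x
        one x = trans (cong (_* x) (⟦⟧-true (lt? i j) l)) (*-identityˡ x)
    both : ∀ i j → ⟦ lt? i j ⟧ * φ i j + ⟦ lt? j i ⟧ * φ i j ≤ φ i j
    both i j = ≤-trans (≤-reflexive (sym (*-distribʳ-+ (φ i j) ⟦ lt? i j ⟧ ⟦ lt? j i ⟧)))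
      (≤-trans (*-monoˡ-≤ (φ i j) (⟦⟧-disjoint (lt? i j) (lt? j i) (yes refl) (λ _ → refl {x = n}) (λ _ → refl) <-asym))
               (≤-reflexive (*-identityˡ (φ i j))))

  -- Sending (a,b) to (a,c) for a suitable c is injective, because a and c give back b.
  middle-injective : {R : Fin n → Fin n → Fin n → Set} (R? : ∀ a b c → Dec (R a b c)) →
    (∀ {a b b′ c} → R a b c → R a b′ c → b ≡ b′) →
    ∑[ a < n ] ∑[ b < n ] ⟦ any? (λ c → R? a b c) ⟧ ≤ ∑[ a < n ] ∑[ c < n ] ⟦ any? (λ b → R? a b c) ⟧
  middle-injective R? inj = ∑-mono λ a → ≤-trans
    (∑-mono λ b → ∃≤∑ (R? a b) (any? (R? a b)) λ x → x)
    (∑-swap≤ (λ c b → ⟦ R? a b c ⟧) (∑-mono λ c → ∑-unique (λ b → R? a b c) (λ b b′ → inj) (any? λ b → R? a b c) λ b x → b , x))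

  pair-injective : {R : Fin n → Fin n → Fin n → Fin n → Set} (R? : ∀ a b x y → Dec (R a b x y)) →
    (∀ {a b a′ b′ x y} → R a b x y → R a′ b′ x y → a ≡ a′ × b ≡ b′) →
    ∑[ a < n ] ∑[ b < n ] ⟦ any? (λ x → any? λ y → R? a b x y) ⟧ ≤ ∑[ x < n ] ∑[ y < n ] ⟦ any? (λ a → any? λ b → R? a b x y) ⟧
  pair-injective R? inj = begin
    ∑[ a < n ] ∑[ b < n ] ⟦ any? (λ x → any? λ y → R? a b x y) ⟧
      ≤⟨ ∑∑-mono (λ a b → ≤-trans (∃≤∑ (λ x → any? (R? a b x)) (any? λ x → any? (R? a b x)) λ x → x)
                                  (∑-mono λ x → ∃≤∑ (R? a b x) (any? (R? a b x)) λ y → y)) ⟩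
    ∑[ a < n ] ∑[ b < n ] ∑[ x < n ] ∑[ y < n ] ⟦ R? a b x y ⟧
      ≡⟨ sum-cong-≗ (λ a → ∑-comm λ b x → ∑[ y < n ] ⟦ R? a b x y ⟧) ⟩
    ∑[ a < n ] ∑[ x < n ] ∑[ b < n ] ∑[ y < n ] ⟦ R? a b x y ⟧
      ≡⟨ ∑-comm (λ a x → ∑[ b < n ] ∑[ y < n ] ⟦ R? a b x y ⟧) ⟩
    ∑[ x < n ] ∑[ a < n ] ∑[ b < n ] ∑[ y < n ] ⟦ R? a b x y ⟧
      ≡⟨ sum-cong-≗ (λ x → sum-cong-≗ λ a → ∑-comm λ b y → ⟦ R? a b x y ⟧) ⟩
    ∑[ x < n ] ∑[ a < n ] ∑[ y < n ] ∑[ b < n ] ⟦ R? a b x y ⟧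
      ≡⟨ sum-cong-≗ (λ x → ∑-comm λ a y → ∑[ b < n ] ⟦ R? a b x y ⟧) ⟩
    ∑[ x < n ] ∑[ y < n ] ∑[ a < n ] ∑[ b < n ] ⟦ R? a b x y ⟧
      ≤⟨ ∑∑-mono (λ x y → ≤-trans
           (∑-mono λ a → ∑-unique (λ b → R? a b x y) (λ b b′ p q → proj₂ (inj p q)) (any? λ b → R? a b x y) λ b r → b , r)
           (∑-unique (λ a → any? λ b → R? a b x y) (λ a a′ (_ , p) (_ , q) → proj₁ (inj p q))
                     (any? λ a → any? λ b → R? a b x y) λ a r → a , r)) ⟩
    ∑[ x < n ] ∑[ y < n ] ⟦ any? (λ a → any? λ b → R? a b x y) ⟧ ∎
    where open ≤-Reasoning

  ∑∑≤size : (S : System n) {Q : Fin n → Fin n → Set} (Q? : ∀ p r → Dec (Q p r)) →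
    (∀ {p r} → Q p r → ∃ λ q → K S p q r) → ∑[ p < n ] ∑[ r < n ] ⟦ Q? p r ⟧ ≤ size S
  ∑∑≤size S Q? f = ∑-mono λ p → ≤-trans (∑-mono λ r → ∃≤∑ (λ q → K? S p q r) (Q? p r) f)
    (≤-reflexive (sym (∑-comm λ q r → ⟦ K? S p q r ⟧)))

⊎×-count : {P Q : Set} (p : Dec P) (q : Dec Q) → ⟦ p ⟧ + ⟦ q ⟧ ≤ ⟦ p ⊎-dec q ⟧ + ⟦ p ×-dec q ⟧
⊎×-count (yes _) (yes _) = ≤-refl
⊎×-count (yes _) (no _)  = ≤-refl
⊎×-count (no _)  (yes _) = ≤-refl
⊎×-count (no _)  (no _)  = ≤-refl

-- Bonferroni: inclusion and exclusion, stopped after the pairwise intersections.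
⊎×-count₃ : {P Q R : Set} (p : Dec P) (q : Dec Q) (r : Dec R) →
  ⟦ p ⟧ + (⟦ q ⟧ + ⟦ r ⟧) ≤ ⟦ p ⊎-dec q ⊎-dec r ⟧ + (⟦ p ×-dec q ⟧ + (⟦ p ×-dec r ⟧ + ⟦ q ×-dec r ⟧))
⊎×-count₃ (yes _) (yes _) (yes _) = m≤n+m 3 1
⊎×-count₃ (yes _) (yes _) (no _)  = ≤-refl
⊎×-count₃ (yes _) (no _)  (yes _) = ≤-refl
⊎×-count₃ (yes _) (no _)  (no _)  = ≤-refl
⊎×-count₃ (no _)  (yes _) (yes _) = ≤-refl
⊎×-count₃ (no _)  (yes _) (no _)  = ≤-refl
⊎×-count₃ (no _)  (no _)  (yes _) = ≤-refl
⊎×-count₃ (no _)  (no _)  (no _)  = ≤-refl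

-- The edge count as a double sum, and the error term

sumˡ-tabulate : ∀ {n} (f : Fin n → ℕ) → sumˡ (tabulate f) ≡ sum f
sumˡ-tabulate {zero}  f = refl
sumˡ-tabulate {suc n} f = cong (f zero +_) (sumˡ-tabulate λ i → f (suc i))

sumˡ-allFin : ∀ {n} (f : Fin n → ℕ) → sumˡ (map f (allFin n)) ≡ sum f
sumˡ-allFin f = trans (cong sumˡ (map-tabulate (λ i → i) f)) (sumˡ-tabulate f)

edge? : ∀ {n} (G : Graph n) i j → Dec (adj G i j ≡ true × toℕ i < toℕ j)
edge? G i j = adj G i j ≟ᵇ true ×-dec toℕ i <? toℕ j

edgeCount-∑ : ∀ {n} (G : Graph n) → edgeCount G ≡ ∑[ i < n ] ∑[ j < n ] ⟦ edge? G i j ⟧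
edgeCount-∑ {n} G = trans (sumˡ-allFin λ i → sumˡ (map (entry i) (allFin n)))
  (sum-cong-≗ λ i → trans (sumˡ-allFin (entry i)) (sum-cong-≗ λ j → indicator (adj G i j) (toℕ i <? toℕ j)))
  where
  entry : Fin n → Fin n → ℕ
  entry i j = if adj G i j ∧ ⌊ toℕ i <? toℕ j ⌋ then 1 else 0
  indicator : ∀ b {P : Set} (d : Dec P) → (if b ∧ ⌊ d ⌋ then 1 else 0) ≡ ⟦ (b ≟ᵇ true) ×-dec d ⟧
  indicator true  (yes _) = refl
  indicator true  (no _)  = refl
  indicator false _       = refl

-- The errors collected in `excess`: 3 n² and a linear term from each of four triple systems, n² and
-- 2 h² n from the degree cutoff at h, and h n from the diagonal. Hence 13 = 4 · 3 + 1.
slack-const : ℕ → ℕ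
slack-const h = 4 * rsConst h (h * h * h) 1 + h + 2 * (h * h)

slack : ℕ → ℕ → ℕ
slack h n = 13 * (n * n) + slack-const h * n

-- Assigning roles to the edges and comparing the four families of pairs

module Assignment {n : ℕ} (G : Graph n) (crit : Diam3Critical G) where
  open Roles G
  open Classify (proj₁ crit)

  base : ∀ u v → Dec (A u v) → Role u v
  base u v (yes uv) = let x , y , ¬w = proj₂ crit u v uv in proj₁ (critical-role uv (blocks ¬w))
  base u v (no _)   = off

  base-just : ∀ u v (d : Dec (A u v)) → base u v d ≡ off ⊎ Justified (base u v d)
  base-just u v (yes uv) = let x , y , ¬w = proj₂ crit u v uv in inj₂ (proj₂ (critical-role uv (blocks ¬w)))
  base-just u v (no _)   = inj₁ refl

  base-edge : ∀ u v (d : Dec (A u v)) → A u v → Justified (base u v d)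
  base-edge u v (yes uv) _  = let x , y , ¬w = proj₂ crit u v uv in proj₂ (critical-role uv (blocks ¬w))
  base-edge u v (no ¬uv) uv = contradiction uv ¬uv

  -- The critical pair is chosen for the orientation u < v only: the counting needs
  -- both orientations of an edge to carry the same pair.
  pick : ∀ u v → Dec (toℕ u < toℕ v) → Role u v
  pick u v (yes _) = base u v (A? u v)
  pick u v (no _)  = swap (base v u (A? v u))

  pick-< : ∀ {u v} d → toℕ u < toℕ v → pick u v d ≡ base u v (A? u v)
  pick-< (yes _) _ = refl
  pick-< (no ¬l) l = contradiction l ¬l

  pick-> : ∀ {u v} d → toℕ v < toℕ u → pick u v d ≡ swap (base v u (A? v u))
  pick-> (yes l) l′ = contradiction l (<-asym l′)
  pick-> (no _)  _  = refl

  role : ∀ u v → Role u v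
  role u v = pick u v (toℕ u <? toℕ v)

  role-just : ∀ u v → role u v ≡ off ⊎ Justified (role u v)
  role-just u v = go (toℕ u <? toℕ v)
    where
    go : ∀ d → pick u v d ≡ off ⊎ Justified (pick u v d)
    go (yes _) = base-just u v (A? u v)
    go (no _)  = Sum.map (cong swap) (swap-just (base v u (A? v u))) (base-just v u (A? v u))

  role-edge : ∀ {u v} → A u v → toℕ u < toℕ v → ∃ λ ρ → Justified ρ × role u v ≡ ρ × role v u ≡ swap ρ
  role-edge {u} {v} uv l = base u v (A? u v) , base-edge u v (A? u v) uv , pick-< (toℕ u <? toℕ v) l , pick-> (toℕ v <? toℕ u) l

  -- `cherryTo` is the other leaf of the cherry that starts at u and has centre v. A primed role has
  -- its value in the reverse orientation, and a `mid` edge has one in both.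
  cherryTo endTo : ∀ {u v} → Role u v → Maybe (Fin n)
  cherryTo (two y)   = just y
  cherryTo (end b y) = just b
  cherryTo (mid x y) = just y
  cherryTo _         = nothing

  endTo (end b y) = just y
  endTo _         = nothing

  midTo : ∀ {u v} → Role u v → Maybe (Fin n × Fin n)
  midTo (mid x y) = just (x , y)
  midTo _         = nothing

  isTwo : ∀ {u v} → Role u v → Bool
  isTwo (two _)  = true
  isTwo (two′ _) = true
  isTwo _        = false

  T F : Fin n → Fin n → Fin n → Set
  T a b c = cherryTo (role a b) ≡ just c
  F x a y = endTo (role x a) ≡ just y

  M : Fin n → Fin n → Fin n → Fin n → Set
  M a b x y = midTo (role a b) ≡ just (x , y)

  T? : ∀ a b c → Dec (T a b c)
  T? a b c = maybe-≟ _≟ᶠ_ (cherryTo (role a b)) (just c)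

  F? : ∀ a b c → Dec (F a b c)
  F? a b c = maybe-≟ _≟ᶠ_ (endTo (role a b)) (just c)

  M? : ∀ a b x y → Dec (M a b x y)
  M? a b x y = maybe-≟ (×-≟ _≟ᶠ_ _≟ᶠ_) (midTo (role a b)) (just (x , y))

  T-functional : ∀ {a b c c′} → T a b c → T a b c′ → c ≡ c′
  T-functional e e′ = just-injective (trans (sym e) e′)

  F-functional : ∀ {a b c c′} → F a b c → F a b c′ → c ≡ c′
  F-functional e e′ = just-injective (trans (sym e) e′)

  M-functional : ∀ {a b x y x′ y′} → M a b x y → M a b x′ y′ → x ≡ x′ × y ≡ y′
  M-functional e e′ with refl ← trans (sym e) e′ = refl , refl

  T⇒Cherry : ∀ {a b c} → T a b c → Cherry a b c
  T⇒Cherry {a} {b} = go (role a b) (role-just a b)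
    where
    go : ∀ (ρ : Role a b) → ρ ≡ off ⊎ Justified ρ → ∀ {c} → cherryTo ρ ≡ just c → Cherry a b c
    go (two y)   (inj₂ j) refl = Two.cherry j
    go (end b y) (inj₂ j) refl = First⇒Cherry j
    go (mid x y) (inj₂ j) refl = Mid⇒Cherry j

  F⇒First : ∀ {x a y} → F x a y → ∃ λ b → First x a b y
  F⇒First {x} {a} = go (role x a) (role-just x a)
    where
    go : ∀ (ρ : Role x a) → ρ ≡ off ⊎ Justified ρ → ∀ {y} → endTo ρ ≡ just y → ∃ λ b → First x a b y
    go (end b y) (inj₂ j) refl = b , j

  M⇒Mid : ∀ {a b x y} → M a b x y → Mid x a b y
  M⇒Mid {a} {b} = go (role a b) (role-just a b)
    where
    go : ∀ (ρ : Role a b) → ρ ≡ off ⊎ Justified ρ → ∀ {x y} → midTo ρ ≡ just (x , y) → Mid x a b y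
    go (mid x y) (inj₂ j) refl = j

  -- The graph of the β edges of the first kind. The disjunction makes its symmetry immediate.
  H : Fin n → Fin n → Set
  H i j = isTwo (role i j) ≡ true ⊎ isTwo (role j i) ≡ true

  H? : ∀ i j → Dec (H i j)
  H? i j = (isTwo (role i j) ≟ᵇ true) ⊎-dec (isTwo (role j i) ≟ᵇ true)

  H-sym : ∀ {i j} → H i j → H j i
  H-sym (inj₁ h) = inj₂ h
  H-sym (inj₂ h) = inj₁ h

  H⇒edge : ∀ {i j} → H i j → A i j × (∀ k → A i k → ¬ A k j)
  H⇒edge {i} {j} = [ go (role i j) (role-just i j)
                   , (λ h → let ji , f = go (role j i) (role-just j i) h in A-sym ji , λ k ik kj → f k (A-sym kj) (A-sym ik)) ]
    where
    go : ∀ {i j} (ρ : Role i j) → ρ ≡ off ⊎ Justified ρ → isTwo ρ ≡ true → A i j × (∀ k → A i k → ¬ A k j)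
    go (two y)  (inj₂ t) _ = Cherry.xw (Two.cherry t) , Two.triangle-free t
    go (two′ y) (inj₂ t) _ = A-sym (Cherry.xw (Two.cherry t)) , λ k ik kj → Two.triangle-free t k (A-sym kj) (A-sym ik)

  im? : ∀ a c → Dec (∃ λ b → T a b c)
  im? a c = any? λ b → T? a b c

  first? : ∀ x y → Dec (∃ λ a → F x a y)
  first? x y = any? λ a → F? x a y

  middle? : ∀ x y → Dec (∃ λ a → ∃ λ b → M a b x y)
  middle? x y = any? λ a → any? λ b → M? a b x y

  F-forced : ∀ {x a y} → F x a y → ∀ p q → A x p → A p q → A q y → p ≡ a
  F-forced f = First.forced (proj₂ (F⇒First f))

  F-path : ∀ {x a y} → F x a y → ∃ λ b → Path x a b y
  F-path f = _ , First.path (proj₂ (F⇒First f))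

  M-path : ∀ {a b x y} → M a b x y → Path x a b y
  M-path m = Mid.path (M⇒Mid m)

  M-forced : ∀ {a b x y} → M a b x y → ∀ p q → A x p → A p q → A q y → p ≡ a × q ≡ b
  M-forced m = Mid.forced (M⇒Mid m)

  -- The pairs assigned from both of their ends. In `closed` the first two triples make q a common
  -- neighbour of p and r, so q is the centre q′ of the third; the other equalities hold because `T`
  -- is functional.
  cherries : System n
  cherries .K p q r  = T p q r × T r q p
  cherries .K? p q r = T? p q r ×-dec T? r q p
  cherries .closed {r = r} (t₁ , t₁′) (t₂ , t₂′) (t₃ , t₃′)
    with refl ← Cherry.unique (T⇒Cherry t₃) _ (Cherry.xw (T⇒Cherry t₁)) (A-sym (Cherry.xw (T⇒Cherry t₂′)))
    = T-functional t₃′ t₂′ , refl , T-functional t₃ t₁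

  -- The pairs counted from both ends. In `closed`, p q b r is a walk, where q b r ends the path of
  -- the second triple. The third triple forces q′ = q, and from r both p and p′ are reached through
  -- b, so `F-functional` identifies them.
  firsts : System n
  firsts .K p q r  = F p q r × ∃ λ b → F r b p
  firsts .K? p q r = F? p q r ×-dec first? r p
  firsts .closed (f₁ , _) (f₂ , _ , g₂) (f₃ , _ , g₃)
    with _ , P₁ ← F-path f₁ | _ , P₂ ← F-path f₂
    with refl ← F-forced f₃ _ _ (Path.xa P₁) (Path.ab P₂) (Path.by P₂)
       | refl ← F-forced g₃ _ _ (A-sym (Path.by P₂)) (A-sym (Path.ab P₂)) (A-sym (Path.xa P₁))
       | refl ← F-forced g₂ _ _ (A-sym (Path.by P₂)) (A-sym (Path.ab P₂)) (A-sym (Path.xa P₂))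
    = F-functional g₃ g₂ , refl , F-functional f₃ f₁

  -- Overlaps of a first edge with a middle edge. The walk that `closed` assembles from the first
  -- two triples must be the unique one of the third; `middle-lasts` is the same at the other end.
  first-middles : System n
  first-middles .K p q r  = F p q r × ∃ λ b → M q b p r
  first-middles .K? p q r = F? p q r ×-dec any? λ b → M? q b p r
  first-middles .closed (f₁ , _) (f₂ , _ , m₂) (f₃ , _ , m₃)
    with _ , P₁ ← F-path f₁ | P₂ ← M-path m₂
    with refl , refl ← M-forced m₃ _ _ (Path.xa P₁) (Path.ab P₂) (Path.by P₂)
    = proj₁ (M-functional m₃ m₂) , refl , F-functional f₃ f₁

  middle-lasts : System n
  middle-lasts .K p q r  = F r q p × ∃ λ a → M a q p r
  middle-lasts .K? p q r = F? r q p ×-dec any? λ a → M? a q p r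
  middle-lasts .closed (f₁ , _ , m₁) (f₂ , _) (f₃ , _ , m₃)
    with P₁ ← M-path m₁ | _ , P₂ ← F-path f₂
    with refl , refl ← M-forced m₃ _ _ (Path.xa P₁) (Path.ab P₁) (A-sym (Path.xa P₂))
    = F-functional f₃ f₂ , refl , proj₂ (M-functional m₃ m₁)

  link? : ∀ i j → Dec ((∃ λ b → T i b j) ⊎ (∃ λ b → T j b i))
  link? i j = im? i j ⊎-dec im? j i

  distant? : ∀ x y → Dec ((∃ λ a → F x a y) ⊎ (∃ λ a → F y a x) ⊎ (∃ λ a → ∃ λ b → M a b x y))
  distant? x y = first? x y ⊎-dec first? y x ⊎-dec middle? x y

  open CommonNeighbours H? using (codeg; multi?; multis; deg)

  manifold? : ∀ i j → Dec (2 ≤ codeg i j × i ≢ j)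
  manifold? i j = multi? i j ×-dec ¬? (i ≟ᶠ j)

  adjacent linked manifold distant : ℕ
  adjacent = ∑[ i < n ] ∑[ j < n ] ⟦ A? i j ⟧
  linked   = ∑[ i < n ] ∑[ j < n ] ⟦ link? i j ⟧
  manifold = ∑[ i < n ] ∑[ j < n ] ⟦ manifold? i j ⟧
  distant  = ∑[ i < n ] ∑[ j < n ] ⟦ distant? i j ⟧

  link-cherry : ∀ {i j} → (∃ λ b → T i b j) ⊎ (∃ λ b → T j b i) →
    ¬ A i j × ∃ λ b → A i b × A b j × (∀ p → A i p → A p j → p ≡ b)
  link-cherry (inj₁ (b , t)) = ¬xy , b , xw , wy , unique
    where
    open Cherry (T⇒Cherry t)
  link-cherry (inj₂ (b , t)) = (λ e → ¬xy (A-sym e)) , b , A-sym wy , A-sym xw , λ p ip pj → unique p (A-sym pj) (A-sym ip)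
    where
    open Cherry (T⇒Cherry t)

  distant-far : ∀ {x y} → (∃ λ a → F x a y) ⊎ (∃ λ a → F y a x) ⊎ (∃ λ a → ∃ λ b → M a b x y) → Far x y
  distant-far (inj₁ (a , f))              = Path.far (proj₂ (F-path f))
  distant-far (inj₂ (inj₁ (a , f)))       = Far-sym (Path.far (proj₂ (F-path f)))
  distant-far (inj₂ (inj₂ (a , b , m)))   = Path.far (M-path m)

  manifold-common : ∀ {i j} → 2 ≤ codeg i j → ∃ λ k → H i k × H k j
  manifold-common {i} {j} two≤ with any? (λ k → H? i k ×-dec H? k j)
  ... | yes x = x
  ... | no ¬x = contradiction (≤-trans two≤ (≤-reflexive (∑-zero λ k → ⟦⟧-false (H? i k ×-dec H? k j) λ x → ¬x (k , x)))) λ ()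

  -- Edges of `H` lie in no triangle, and ij would close one over a common `H`-neighbour.
  manifold-¬adj : ∀ {i j} → 2 ≤ codeg i j → ¬ A i j
  manifold-¬adj two≤ ij = let k , ik , kj = manifold-common two≤ in
    proj₂ (H⇒edge ik) _ ij (A-sym (proj₁ (H⇒edge kj)))

  manifold-¬link : ∀ {i j} → 2 ≤ codeg i j → ¬ ((∃ λ b → T i b j) ⊎ (∃ λ b → T j b i))
  manifold-¬link {i} {j} two≤ l = let _ , b , _ , _ , unique = link-cherry l in
    <⇒≱ (n<1+n 1) (≤-trans two≤ (∑-unique (λ k → H? i k ×-dec H? k j)
      (λ k k′ (a , c) (a′ , c′) → trans (unique k (proj₁ (H⇒edge a)) (proj₁ (H⇒edge c)))
                                        (sym (unique k′ (proj₁ (H⇒edge a′)) (proj₁ (H⇒edge c′)))))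
      (yes refl) λ _ _ → refl {x = n}))

  pairs-disjoint : adjacent + (linked + (manifold + distant)) ≤ n * n
  pairs-disjoint = begin
    adjacent + (linked + (manifold + distant))
      ≡⟨ cong (λ z → adjacent + (linked + z)) (∑∑-distrib-+ {n} {n} (λ i j → ⟦ manifold? i j ⟧) _) ⟨
    adjacent + (linked + ∑[ i < n ] ∑[ j < n ] (⟦ manifold? i j ⟧ + ⟦ distant? i j ⟧))
      ≡⟨ cong (adjacent +_) (∑∑-distrib-+ {n} {n} (λ i j → ⟦ link? i j ⟧) _) ⟨
    adjacent + ∑[ i < n ] ∑[ j < n ] (⟦ link? i j ⟧ + (⟦ manifold? i j ⟧ + ⟦ distant? i j ⟧))
      ≡⟨ ∑∑-distrib-+ {n} {n} (λ i j → ⟦ A? i j ⟧) _ ⟨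
    ∑[ i < n ] ∑[ j < n ] (⟦ A? i j ⟧ + (⟦ link? i j ⟧ + (⟦ manifold? i j ⟧ + ⟦ distant? i j ⟧)))
      ≤⟨ ∑-bound (λ i → ≤-trans (∑-bound λ j → exclusive i j) (≤-reflexive (*-identityʳ n))) ⟩
    n * n ∎
    where
    open ≤-Reasoning
    exclusive : ∀ i j → ⟦ A? i j ⟧ + (⟦ link? i j ⟧ + (⟦ manifold? i j ⟧ + ⟦ distant? i j ⟧)) ≤ 1
    exclusive i j = ≤-trans (+-monoʳ-≤ ⟦ A? i j ⟧ (≤-trans (+-monoʳ-≤ ⟦ link? i j ⟧
        (⟦⟧-disjoint (manifold? i j) (distant? i j) (manifold? i j ⊎-dec distant? i j) inj₁ inj₂ md))
        (⟦⟧-disjoint (link? i j) (manifold? i j ⊎-dec distant? i j) (link? i j ⊎-dec (manifold? i j ⊎-dec distant? i j)) inj₁ inj₂ lmd)))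
        (⟦⟧-disjoint (A? i j) (link? i j ⊎-dec (manifold? i j ⊎-dec distant? i j)) (yes refl) (λ _ → refl {x = n}) (λ _ → refl) almd)
      where
      md : _ → ¬ _
      md (two≤ , _) d = let k , ik , kj = manifold-common two≤ in
        Far.¬common (distant-far d) k (proj₁ (H⇒edge ik)) (proj₁ (H⇒edge kj))
      lmd : _ → ¬ (_ ⊎ _)
      lmd l (inj₁ (two≤ , _)) = manifold-¬link two≤ l
      lmd l (inj₂ d) = let _ , b , ib , bj , _ = link-cherry l in Far.¬common (distant-far d) b ib bj
      almd : _ → ¬ (_ ⊎ (_ ⊎ _))
      almd e (inj₁ l) = proj₁ (link-cherry l) e
      almd e (inj₂ (inj₁ (two≤ , _))) = manifold-¬adj two≤ e
      almd e (inj₂ (inj₂ d)) = Far.¬xy (distant-far d) e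

  e : ℕ
  e = edgeCount G

  ∑edge-≤ : ∀ k (φ : Fin n → Fin n → ℕ) → (∀ i j → A i j → toℕ i < toℕ j → k ≤ φ i j + φ j i) →
            k * e ≤ ∑[ i < n ] ∑[ j < n ] φ i j
  ∑edge-≤ k φ h = ≤-trans (≤-reflexive (trans (cong (k *_) (edgeCount-∑ G)) (*-∑∑ {n} {n} k _)))
    (∑<-≤ (λ i j → k * ⟦ edge? G i j ⟧) φ
      (λ i j ¬l → trans (cong (k *_) (⟦⟧-false (edge? G i j) λ (_ , l) → ¬l l)) (*-zeroʳ k))
      (λ i j l → row i j l (A? i j)))
    where
    row : ∀ i j → toℕ i < toℕ j → Dec (A i j) → k * ⟦ edge? G i j ⟧ ≤ φ i j + φ j i
    row i j l (yes a) = ≤-trans (*-monoʳ-≤ k (⟦⟧≤1 (edge? G i j))) (≤-trans (≤-reflexive (*-identityʳ k)) (h i j a l))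
    row i j l (no ¬a) = ≤-trans (≤-reflexive (trans (cong (k *_) (⟦⟧-false (edge? G i j) λ (a , _) → ¬a a)) (*-zeroʳ k))) z≤n

  adjacent-≥ : 2 * e ≤ adjacent
  adjacent-≥ = ∑edge-≤ 2 (λ i j → ⟦ A? i j ⟧) λ i j a _ → +-mono-≤ (⟦⟧-pos (A? i j) a) (⟦⟧-pos (A? j i) (A-sym a))

  images : ℕ
  images = ∑[ i < n ] ∑[ j < n ] ⟦ im? i j ⟧

  -- Every role yields a cherry in at least one orientation, and its two leaves determine the
  -- centre.
  images-≥ : e ≤ images
  images-≥ = ≤-trans (≤-reflexive (sym (*-identityˡ e))) (≤-trans
    (∑edge-≤ 1 (λ a b → ⟦ any? (T? a b) ⟧) λ i j a l → go i j (role-edge a l))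
    (middle-injective T? λ t t′ → Cherry.unique (T⇒Cherry t′) _ (Cherry.xw (T⇒Cherry t)) (Cherry.wy (T⇒Cherry t))))
    where
    left : ∀ {a b c x} → T a b c → 1 ≤ ⟦ any? (T? a b) ⟧ + x
    left {a} {b} t = ≤-trans (⟦⟧-pos (any? (T? a b)) (_ , t)) (m≤m+n _ _)
    right : ∀ {a b c x} → T a b c → 1 ≤ x + ⟦ any? (T? a b) ⟧
    right {a} {b} t = ≤-trans (⟦⟧-pos (any? (T? a b)) (_ , t)) (m≤n+m _ _)
    go : ∀ i j → (∃ λ ρ → Justified ρ × role i j ≡ ρ × role j i ≡ swap ρ) → 1 ≤ ⟦ any? (T? i j) ⟧ + ⟦ any? (T? j i) ⟧
    go i j (two y    , _ , e₁ , e₂) = left (cong cherryTo e₁)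
    go i j (two′ y   , _ , e₁ , e₂) = right (cong cherryTo e₂)
    go i j (end b y  , _ , e₁ , e₂) = left (cong cherryTo e₁)
    go i j (end′ b y , _ , e₁ , e₂) = right (cong cherryTo e₂)
    go i j (mid x y  , _ , e₁ , e₂) = left (cong cherryTo e₁)

  -- A pair that is an image in both orders has the same centre both times, by uniqueness of the
  -- common neighbour, so the overlap is counted by `cherries`.
  linked-≥ : 2 * images ≤ linked + size cherries
  linked-≥ = begin
    2 * images
      ≡⟨ cong (images +_) (trans (+-identityʳ images) (sym (∑∑-transpose λ i j → ⟦ im? i j ⟧))) ⟩
    images + ∑[ i < n ] ∑[ j < n ] ⟦ im? j i ⟧
      ≡⟨ ∑∑-distrib-+ {n} {n} (λ i j → ⟦ im? i j ⟧) _ ⟨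
    ∑[ i < n ] ∑[ j < n ] (⟦ im? i j ⟧ + ⟦ im? j i ⟧)
      ≤⟨ ∑∑-mono (λ i j → ⊎×-count (im? i j) (im? j i)) ⟩
    ∑[ i < n ] ∑[ j < n ] (⟦ link? i j ⟧ + ⟦ im? i j ×-dec im? j i ⟧)
      ≡⟨ ∑∑-distrib-+ {n} {n} (λ i j → ⟦ link? i j ⟧) _ ⟩
    linked + ∑[ i < n ] ∑[ j < n ] ⟦ im? i j ×-dec im? j i ⟧
      ≤⟨ +-monoʳ-≤ linked (∑∑≤size cherries (λ i j → im? i j ×-dec im? j i) double) ⟩
    linked + size cherries ∎
    where
    open ≤-Reasoning
    double : ∀ {p r} → (∃ λ b → T p b r) × (∃ λ b → T r b p) → ∃ λ q → T p q r × T r q p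
    double ((q , t) , (q′ , t′))
      with refl ← Cherry.unique (T⇒Cherry t) q′ (A-sym (Cherry.wy (T⇒Cherry t′))) (A-sym (Cherry.xw (T⇒Cherry t′))) = q , t , t′

  ends mids twos : ℕ
  ends = ∑[ x < n ] ∑[ y < n ] ⟦ first? x y ⟧
  mids = ∑[ x < n ] ∑[ y < n ] ⟦ middle? x y ⟧
  twos = ∑[ i < n ] ∑[ j < n ] ⟦ H? i j ⟧

  distant-≥ : 2 * ends + mids ≤ distant + (size firsts + (size first-middles + size middle-lasts))
  distant-≥ = begin
    2 * ends + mids
      ≡⟨ trans (cong (λ z → ends + z + mids) (trans (+-identityʳ ends) (sym (∑∑-transpose λ i j → ⟦ first? i j ⟧)))) (+-assoc ends _ mids) ⟩
    ends + (∑[ x < n ] ∑[ y < n ] ⟦ first? y x ⟧ + mids)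
      ≡⟨ cong (ends +_) (∑∑-distrib-+ {n} {n} (λ x y → ⟦ first? y x ⟧) _) ⟨
    ends + ∑[ x < n ] ∑[ y < n ] (⟦ first? y x ⟧ + ⟦ middle? x y ⟧)
      ≡⟨ ∑∑-distrib-+ {n} {n} (λ x y → ⟦ first? x y ⟧) _ ⟨
    ∑[ x < n ] ∑[ y < n ] (⟦ first? x y ⟧ + (⟦ first? y x ⟧ + ⟦ middle? x y ⟧))
      ≤⟨ ∑∑-mono (λ x y → ⊎×-count₃ (first? x y) (first? y x) (middle? x y)) ⟩
    ∑[ x < n ] ∑[ y < n ] (⟦ distant? x y ⟧ + (⟦ ff? x y ⟧ + (⟦ fm? x y ⟧ + ⟦ ml? x y ⟧)))
      ≡⟨ ∑∑-distrib-+ {n} {n} (λ x y → ⟦ distant? x y ⟧) _ ⟩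
    distant + ∑[ x < n ] ∑[ y < n ] (⟦ ff? x y ⟧ + (⟦ fm? x y ⟧ + ⟦ ml? x y ⟧))
      ≡⟨ cong (distant +_) (trans (∑∑-distrib-+ {n} {n} (λ x y → ⟦ ff? x y ⟧) _)
           (cong (∑[ x < n ] ∑[ y < n ] ⟦ ff? x y ⟧ +_) (∑∑-distrib-+ {n} {n} (λ x y → ⟦ fm? x y ⟧) _))) ⟩
    distant + (∑[ x < n ] ∑[ y < n ] ⟦ ff? x y ⟧ + (∑[ x < n ] ∑[ y < n ] ⟦ fm? x y ⟧ + ∑[ x < n ] ∑[ y < n ] ⟦ ml? x y ⟧))
      ≤⟨ +-monoʳ-≤ distant (+-mono-≤ (∑∑≤size firsts ff? λ ((a , f) , g) → a , f , g)
           (+-mono-≤ (∑∑≤size first-middles fm? first-mid) (∑∑≤size middle-lasts ml? mid-last))) ⟩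
    distant + (size firsts + (size first-middles + size middle-lasts)) ∎
    where
    open ≤-Reasoning
    ff? : ∀ x y → Dec ((∃ λ a → F x a y) × (∃ λ a → F y a x))
    ff? x y = first? x y ×-dec first? y x
    fm? : ∀ x y → Dec ((∃ λ a → F x a y) × (∃ λ a → ∃ λ b → M a b x y))
    fm? x y = first? x y ×-dec middle? x y
    ml? : ∀ x y → Dec ((∃ λ a → F y a x) × (∃ λ a → ∃ λ b → M a b x y))
    ml? x y = first? y x ×-dec middle? x y
    first-mid : ∀ {x y} → (∃ λ a → F x a y) × (∃ λ a → ∃ λ b → M a b x y) → ∃ λ q → F x q y × ∃ λ b → M q b x y
    first-mid ((a , f) , (a′ , b , m)) with P ← M-path m
      with refl ← F-forced f _ _ (Path.xa P) (Path.ab P) (Path.by P) = a , f , b , m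
    mid-last : ∀ {x y} → (∃ λ a → F y a x) × (∃ λ a → ∃ λ b → M a b x y) → ∃ λ q → F y q x × ∃ λ a → M a q x y
    mid-last ((b , f) , (a , b′ , m)) with P ← M-path m
      with refl ← F-forced f _ _ (A-sym (Path.by P)) (A-sym (Path.ab P)) (A-sym (Path.xa P)) = b , f , a , m

  -- Each edge is worth 2 over its orientations. The roles `two` and `mid` show in both
  -- orientations, an end role in only one, which explains the factor 2 before `ends`.
  roles-≥ : 2 * e ≤ twos + (2 * ends + mids)
  roles-≥ = begin
    2 * e
      ≤⟨ ∑edge-≤ 2 (λ i j → two₁ i j + (2 * end₁ i j + mid₁ i j)) (λ i j a l → go i j (role-edge a l)) ⟩
    ∑[ i < n ] ∑[ j < n ] (two₁ i j + (2 * end₁ i j + mid₁ i j))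
      ≡⟨ trans (∑∑-distrib-+ {n} {n} two₁ _) (cong (twos +_) (trans (∑∑-distrib-+ {n} {n} (λ i j → 2 * end₁ i j) mid₁)
           (cong (_+ ∑[ i < n ] ∑[ j < n ] mid₁ i j) (sym (*-∑∑ {n} {n} 2 end₁))))) ⟩
    twos + (2 * ∑[ i < n ] ∑[ j < n ] end₁ i j + ∑[ i < n ] ∑[ j < n ] mid₁ i j)
      ≤⟨ +-monoʳ-≤ twos (+-mono-≤ (*-monoʳ-≤ 2 (middle-injective F? λ f f′ → let b , P = F-path f in F-forced f′ _ _ (Path.xa P) (Path.ab P) (Path.by P)))
           (pair-injective M? λ m m′ → let P = M-path m in M-forced m′ _ _ (Path.xa P) (Path.ab P) (Path.by P))) ⟩
    twos + (2 * ends + mids) ∎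
    where
    open ≤-Reasoning
    two₁ end₁ mid₁ : Fin n → Fin n → ℕ
    two₁ i j  = ⟦ H? i j ⟧
    end₁ i j = ⟦ any? (F? i j) ⟧
    mid₁ i j = ⟦ any? (λ x → any? (M? i j x)) ⟧
    byTwo : ∀ i j → H i j → 2 ≤ two₁ i j + (2 * end₁ i j + mid₁ i j) + (two₁ j i + (2 * end₁ j i + mid₁ j i))
    byTwo i j h = +-mono-≤ (≤-trans (⟦⟧-pos (H? i j) h) (m≤m+n _ _)) (≤-trans (⟦⟧-pos (H? j i) (H-sym h)) (m≤m+n _ _))
    byEnd : ∀ i j {y} → F i j y → 2 ≤ two₁ i j + (2 * end₁ i j + mid₁ i j)
    byEnd i j f = ≤-trans (*-monoʳ-≤ 2 (⟦⟧-pos (any? (F? i j)) (_ , f))) (≤-trans (m≤m+n _ (mid₁ i j)) (m≤n+m _ (two₁ i j)))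
    byMid : ∀ i j {x y} → M i j x y → 1 ≤ two₁ i j + (2 * end₁ i j + mid₁ i j)
    byMid i j m = ≤-trans (⟦⟧-pos (any? (λ x → any? (M? i j x))) (_ , _ , m)) (≤-trans (m≤n+m _ (2 * end₁ i j)) (m≤n+m _ (two₁ i j)))
    go : ∀ i j → (∃ λ ρ → Justified ρ × role i j ≡ ρ × role j i ≡ swap ρ) →
         2 ≤ two₁ i j + (2 * end₁ i j + mid₁ i j) + (two₁ j i + (2 * end₁ j i + mid₁ j i))
    go i j (two y    , _ , e₁ , e₂) = byTwo i j (inj₁ (cong isTwo e₁))
    go i j (two′ y   , _ , e₁ , e₂) = byTwo i j (inj₁ (cong isTwo e₁))
    go i j (end b y  , _ , e₁ , e₂) = ≤-trans (byEnd i j (cong endTo e₁)) (m≤m+n _ _)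
    go i j (end′ b y , _ , e₁ , e₂) = ≤-trans (byEnd j i (cong endTo e₂)) (m≤n+m _ (two₁ i j + (2 * end₁ i j + mid₁ i j)))
    go i j (mid x y  , _ , e₁ , e₂) = +-mono-≤ (byMid i j (cong midTo e₁)) (byMid j i (cong midTo e₂))

  -- The pairs lost are the at most n diagonal ones, whose 2-walks go back and forth.
  multi≤manifold : ∑[ i < n ] multis i ≤ manifold + n
  multi≤manifold = begin
    ∑[ i < n ] multis i
      ≤⟨ ∑∑-mono (λ i j → split i j (i ≟ᶠ j)) ⟩
    ∑[ i < n ] ∑[ j < n ] (⟦ manifold? i j ⟧ + ⟦ i ≟ᶠ j ⟧)
      ≡⟨ ∑∑-distrib-+ {n} {n} (λ i j → ⟦ manifold? i j ⟧) _ ⟩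
    manifold + ∑[ i < n ] ∑[ j < n ] ⟦ i ≟ᶠ j ⟧
      ≤⟨ +-monoʳ-≤ manifold (≤-trans (∑-bound {n = n} {f = λ i → ∑[ j < n ] ⟦ i ≟ᶠ j ⟧} λ i → ∑-unique (i ≟ᶠ_) (λ j j′ p q → trans (sym p) q) (yes refl) λ _ _ → refl {x = n})
                                      (≤-reflexive (*-identityʳ n))) ⟩
    manifold + n ∎
    where
    open ≤-Reasoning
    split : ∀ i j → Dec (i ≡ j) → ⟦ multi? i j ⟧ ≤ ⟦ manifold? i j ⟧ + ⟦ i ≟ᶠ j ⟧
    split i j (yes p) = ≤-trans (⟦⟧≤1 (multi? i j)) (≤-trans (⟦⟧-pos (i ≟ᶠ j) p) (m≤n+m _ _))
    split i j (no ¬p) = ≤-trans (⟦⟧-mono (multi? i j) (manifold? i j) λ m → m , ¬p) (m≤m+n _ _)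

  excess : ∀ h′ → let h = suc h′ in
    h * (6 * e) ≤ h * (n * n) + slack h n
  excess h′ = begin
    h * (6 * e)
      ≡⟨ split-six h e ⟩
    h * (2 * e) + h * (2 * e) + h * (2 * e)
      -- One 2e each for the adjacent pairs, for the assigned cherries, and for the two kinds of
      -- edges together.
      ≤⟨ +-mono-≤ (+-mono-≤ (*-monoʳ-≤ h adjacent-≥) (*-monoʳ-≤ h (≤-trans (*-monoʳ-≤ 2 images-≥) linked-≥)))
                  (*-monoʳ-≤ h roles-≥) ⟩
    h * adjacent + h * (linked + s₁) + h * (twos + (2 * ends + mids))
      ≡⟨ cong (h * adjacent + h * (linked + s₁) +_) (*-distribˡ-+ h twos (2 * ends + mids)) ⟩
    h * adjacent + h * (linked + s₁) + (h * twos + h * (2 * ends + mids))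
      ≤⟨ +-monoʳ-≤ (h * adjacent + h * (linked + s₁)) (+-mono-≤
           (≤-trans (Cutoff.degrees≤multis H-sym h (s≤s z≤n)) (+-monoˡ-≤ _ (*-monoʳ-≤ h multi≤manifold)))
           (*-monoʳ-≤ h distant-≥)) ⟩
    h * adjacent + h * (linked + s₁) + (h * (manifold + n) + (n * n + h * (2 * (n * h))) + h * (distant + (s₂ + (s₃ + s₄))))
      ≡⟨ collect h n adjacent linked manifold distant s₁ s₂ s₃ s₄ ⟩
    h * (adjacent + (linked + (manifold + distant))) + (h * s₁ + (h * s₂ + (h * s₃ + h * s₄)) + (h * n + (n * n + h * (2 * (n * h)))))
      ≤⟨ +-mono-≤ (*-monoʳ-≤ h pairs-disjoint) (+-monoˡ-≤ (h * n + (n * n + h * (2 * (n * h))))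
           (+-mono-≤ (ruzsa-szemerédi h′ cherries) (+-mono-≤ (ruzsa-szemerédi h′ firsts)
             (+-mono-≤ (ruzsa-szemerédi h′ first-middles) (ruzsa-szemerédi h′ middle-lasts))))) ⟩
    h * (n * n) + (b + (b + (b + b)) + (h * n + (n * n + h * (2 * (n * h)))))
      ≡⟨ cong (h * (n * n) +_) (total h n c) ⟩
    h * (n * n) + (13 * (n * n) + (4 * c + h + 2 * (h * h)) * n) ∎
    where
    open ≤-Reasoning
    open CommonNeighbours H? using (module Cutoff)
    h = suc h′
    c = rsConst h (h * h * h) 1
    b = 3 * (n * n) + c * n
    s₁ = size cherries
    s₂ = size firsts
    s₃ = size first-middles
    s₄ = size middle-lasts
    split-six : ∀ h e → h * (6 * e) ≡ h * (2 * e) + h * (2 * e) + h * (2 * e)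
    split-six = solve-∀
    collect : ∀ h n a l m d s₁ s₂ s₃ s₄ →
      h * a + h * (l + s₁) + (h * (m + n) + (n * n + h * (2 * (n * h))) + h * (d + (s₂ + (s₃ + s₄)))) ≡
      h * (a + (l + (m + d))) + (h * s₁ + (h * s₂ + (h * s₃ + h * s₄)) + (h * n + (n * n + h * (2 * (n * h)))))
    collect = solve-∀
    total : ∀ h n c → (let b = 3 * (n * n) + c * n) → b + (b + (b + b)) + (h * n + (n * n + h * (2 * (n * h)))) ≡
      13 * (n * n) + (4 * c + h + 2 * (h * h)) * n
    total = solve-∀

-- Minimising over h ≤ m + 1 replaces a choice of h as a function of n.
bound : ℕ → ℕ → ℕ
bound n zero    = slack 1 n
bound n (suc j) = bound n j ⊓ (slack (2+ j) n / (2+ j))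

bound-≤ : ∀ n {j} m → j ≤ m → bound n m ≤ slack (suc j) n / suc j
bound-≤ n {zero} zero z≤n = ≤-reflexive (sym (n/1≡n (slack 1 n)))
bound-≤ n (suc m) j≤ with m≤n⇒m<n∨m≡n j≤
... | inj₁ (s≤s j≤m) = ≤-trans (m⊓n≤m _ _) (bound-≤ n m j≤m)
... | inj₂ refl      = m⊓n≤n (bound n m) _

bound-≥ : ∀ {x n} → (∀ h′ → suc h′ * x ≤ suc h′ * (n * n) + slack (suc h′) n) → ∀ m → x ≤ n * n + bound n m
bound-≥ {x} {n} H m = ≤-trans (m≤n+m∸n x (n * n)) (+-monoʳ-≤ (n * n) (go m))
  where
  scaled : ∀ h′ → (x ∸ n * n) * suc h′ ≤ slack (suc h′) n
  scaled h′ = ≤-trans (≤-reflexive (trans (*-comm (x ∸ n * n) (suc h′)) (*-distribˡ-∸ (suc h′) x (n * n))))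
                      (m≤n+o⇒m∸n≤o (suc h′ * x) (suc h′ * (n * n)) (H h′))
  go : ∀ m → x ∸ n * n ≤ bound n m
  go zero    = ≤-trans (≤-reflexive (sym (*-identityʳ _))) (scaled 0)
  go (suc m) = ⊓-glb (go m) (*≤⇒≤/ (scaled (suc m)))
    where
    *≤⇒≤/ : ∀ {a b} → a * suc (suc m) ≤ b → a ≤ b / suc (suc m)
    *≤⇒≤/ {a} h = ≤-trans (≤-reflexive (sym (m*n/n≡m a (suc (suc m))))) (/-monoˡ-≤ (suc (suc m)) h)

-- In the threshold, `suc j` puts h = j + 1 within the range of the minimum, and `slack-const` makes
-- the linear term at most n², which is rounded up to 13 n².
bound-eventually : ∀ j n → suc j + slack-const (suc j) ≤ n → suc j * bound n n ≤ 26 * (n * n)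
bound-eventually j n N≤n = begin
  suc j * bound n n                    ≤⟨ *-monoʳ-≤ (suc j) (bound-≤ n n (≤-trans (n≤1+n j) (m+n≤o⇒m≤o (suc j) N≤n))) ⟩
  suc j * (slack (suc j) n / suc j)    ≡⟨ *-comm (suc j) (slack (suc j) n / suc j) ⟩
  slack (suc j) n / suc j * suc j      ≤⟨ m/n*n≤m (slack (suc j) n) (suc j) ⟩
  13 * (n * n) + slack-const (suc j) * n ≤⟨ +-monoʳ-≤ (13 * (n * n)) (*-monoˡ-≤ n (m+n≤o⇒n≤o (suc j) N≤n)) ⟩
  13 * (n * n) + n * n                 ≤⟨ +-monoʳ-≤ (13 * (n * n)) (m≤n*m (n * n) 13) ⟩
  13 * (n * n) + 13 * (n * n)          ≡⟨ *-distribʳ-+ (n * n) 13 13 ⟨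
  26 * (n * n)                         ∎
  where open ≤-Reasoning

bound-small : ∀ k → ∃[ N ] (∀ n → N ≤ n → suc k * bound n n ≤ n * n)
-- The number `suc (k + 25 * suc k)` is the unfolded `26 * suc k`, and this choice of h absorbs the
-- constant 26.
bound-small k = suc (k + 25 * suc k) + slack-const (suc (k + 25 * suc k)) , λ n N≤n → *-cancelˡ-≤ 26
  (≤-trans (≤-reflexive (sym (*-assoc 26 (suc k) (bound n n)))) (bound-eventually (k + 25 * suc k) n N≤n))

theorem1p8 : Σ (ℕ → ℕ) λ f → ((∀ (k : ℕ) → ∃[ N ] (∀ (n : ℕ) → N ≤ n → suc k * f n ≤ n * n))
    × (∀ (n : ℕ) (G : Graph n) → Diam3Critical G → 6 * edgeCount G ≤ n * n + 6 * f n))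
theorem1p8 = (λ n → bound n n) , bound-small , λ n G crit →
  -- Minimising up to m = n eventually includes every fixed h.
  ≤-trans (bound-≥ (Assignment.excess G crit) n) (+-monoʳ-≤ (n * n) (m≤n*m (bound n n) 6))
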